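{- Let $\mathcal{A}=(\mathbb{G}_a^m,\Phi)$ be a $T$-module defined over a field $\mathcal{F}\subset\overline{k}$ such that there exists a positive integer $i$ for which the leading coefficient matrix of $\Phi(T^i)\in\mathcal{F}^{m,m}\{\tau\}$ is invertible. Then $\mathcal{A}$ is abelian.
   Context: $A=\mathbb{F}_q[T]$, $k=\mathbb{F}_q(T)$, $\tau$ the Frobenius $z\mapsto z^q$, and $\mathcal{F}^{m,m}\{\tau\}$ the twisted polynomial ring with $\tau M=M^{(q)}\tau$ (entrywise $q$-th power). A $T$-module of dimension $m$ over $\mathcal{F}$ is $\mathcal{A}=(\mathbb{G}_a^m,\Phi)$ with $\Phi:A\to\mathcal{F}^{m,m}\{\tau\}$ an $\mathbb{F}_q$-algebra homomorphism, $\Phi(T)=\sum_{i=0}^{\tilde d}a_i\tau^i$, $a_{\tilde d}\ne0$, $a_0=TI_m+N$ with $N$ nilpotent. $\mathrm{Hom}_{\mathcal{F}}(\mathcal{A},\mathbb{G}_a)$ denotes the $\mathbb{F}_q$-linear algebraic group homomorphisms $\mathbb{G}_a^m\to\mathbb{G}_a$ defined over $\mathcal{F}$, identified with $\mathcal{F}\{\tau\}^m$ (row vectors), made into an $\mathcal{F}[T]$-module by letting $\mathcal{F}$ act by left multiplication and $T\cdot f=f\circ\Phi(T)$. $\mathcal{A}$ is abelian if this $\mathcal{F}[T]$-module has finite rank.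
   Formalization: It is additionally assumed that Φ(T) has positive degree in τ: if Φ(T)=TI_m+N is constant, the leading coefficient is invertible but Hom is infinite-dimensional torsion, so never abelian. "Finite rank" is read as finitely generated. -}

module Defs where

open import Algebra.Bundles using (CommutativeRing)
open import Algebra.Bundles.Raw using (RawRing)
open import Algebra.Definitions using (Invertible)
open import Algebra.Module.Bundles.Raw using (RawLeftModule)
open import Algebra.Morphism.Structures using (module RingMorphisms)
import Algebra.Definitions.RawMonoid as RawMonoidDefs
import Algebra.Definitions.RawSemiring as RawSemiringDefs
open import Data.Bool.Base using (if_then_else_)
open import Data.Fin.Base using (Fin)
open import Data.Fin.Properties using (_≟_)
open import Data.List.Base using (List; []; _∷_; map)
open import Data.Nat.Base as ℕ using (ℕ; zero; suc)
open import Data.Nat.Primality using (Prime)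
open import Data.Product.Base using (Σ; ∃; _×_)
open import Data.Vec.Functional using (Vector)
open import Function.Base using (id; _∘_)
open import Function.Bundles using (Inverse)
open import Level using (Level; _⊔_) renaming (suc to lsuc)
open import Relation.Binary.PropositionalEquality using (setoid)
open import Relation.Nullary.Decidable.Core using (does)
open import Relation.Nullary.Negation.Core using (¬_)

-- Fields with the classical axiom "x ≉ 0 implies x invertible", without the
-- apartness relation of Algebra.Apartness.HeytingField.

record Field (c ℓ : Level) : Set (lsuc (c ⊔ ℓ)) where
  field
    commutativeRing : CommutativeRing c ℓ
  open CommutativeRing commutativeRing public
  field
    1≉0     : ¬ (1# ≈ 0#)
    inverse : ∀ x → ¬ (x ≈ 0#) → Invertible _≈_ 1# _*_ x

-- The ring R{τ} with τ a = σ(a) τ.  A list a₀ ∷ a₁ ∷ … stands for Σᵢ aᵢ τⁱ;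
-- equality is coefficientwise, so trailing zeros are immaterial.

module Twisted {a ℓ : Level} (R : RawRing a ℓ)
               (σ : RawRing.Carrier R → RawRing.Carrier R) where
  open RawRing R

  coeff : List Carrier → ℕ → Carrier
  coeff []      _       = 0#
  coeff (x ∷ p) zero    = x
  coeff (x ∷ p) (suc n) = coeff p n

  infixl 6 _+ₚ_
  infixl 7 _*ₚ_

  _+ₚ_ : List Carrier → List Carrier → List Carrier
  []      +ₚ q       = q
  (x ∷ p) +ₚ []      = x ∷ p
  (x ∷ p) +ₚ (y ∷ q) = (x + y) ∷ (p +ₚ q)

  scale : Carrier → List Carrier → List Carrier
  scale x = map (x *_)

  -- (x + p τ) q = x q + (p σ(q)) τ, with σ applied to the coefficients of q.
  _*ₚ_ : List Carrier → List Carrier → List Carrier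
  []      *ₚ q = []
  (x ∷ p) *ₚ q = scale x q +ₚ (0# ∷ (p *ₚ map σ q))

  ring : RawRing a ℓ
  ring = record
    { Carrier = List Carrier
    ; _≈_     = λ p q → ∀ n → coeff p n ≈ coeff q n
    ; _+_     = _+ₚ_
    ; _*_     = _*ₚ_
    ; -_      = map -_
    ; 0#      = []
    ; 1#      = 1# ∷ []
    }

  record HasLeadingCoeff (p : List Carrier) (d : ℕ) (x : Carrier) : Set ℓ where
    field
      coeff≈  : coeff p d ≈ x
      nonzero : ¬ (x ≈ 0#)
      above   : ∀ n → d ℕ.< n → coeff p n ≈ 0#

module Poly {a ℓ : Level} (R : RawRing a ℓ) where
  open RawRing R
  open Twisted R id public

  X : List Carrier
  X = 0# ∷ 1# ∷ []

  eval : List Carrier → Carrier → Carrier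
  eval []      _ = 0#
  eval (y ∷ p) x = y + x * eval p x

-- The algebra of m × m matrices R^{m,m}.

module Matrix {a ℓ : Level} (R : RawRing a ℓ) (m : ℕ) where
  open RawRing R
  open RawMonoidDefs +-rawMonoid using (sum)

  Mat : Set a
  Mat = Fin m → Fin m → Carrier

  scalar : Carrier → Mat
  scalar x i j = if does (i ≟ j) then x else 0#

  ring : RawRing a ℓ
  ring = record
    { Carrier = Mat
    ; _≈_     = λ M N → ∀ i j → M i j ≈ N i j
    ; _+_     = λ M N i j → M i j + N i j
    ; _*_     = λ M N i j → sum (λ l → M i l * N l j)
    ; -_      = λ M i j → - M i j
    ; 0#      = λ _ _ → 0#
    ; 1#      = scalar 1#
    }

FinitelyGenerated : ∀ {r a ℓ} {R : Set r} → RawLeftModule R a ℓ → Set (r ⊔ a ⊔ ℓ)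
FinitelyGenerated {R = R} M =
  Σ ℕ λ r → Σ (Vector Carrierᴹ r) λ g →
    ∀ f → Σ (Vector R r) λ x → f ≈ᴹ sum (λ i → x i *ₗ g i)
  where
  open RawLeftModule M
  open RawMonoidDefs +ᴹ-rawMonoid using (sum)

module _ {c ℓ : Level} (K L : Field c ℓ) where
  private
    module K = Field K
    module L = Field L

  record FieldEmbedding : Set (c ⊔ ℓ) where
    field
      ⟦_⟧ : K.Carrier → L.Carrier
      isRingMonomorphism :
        RingMorphisms.IsRingMonomorphism K.rawRing L.rawRing ⟦_⟧

  record IsAlgebraicClosure (ι : FieldEmbedding) : Set (c ⊔ ℓ) where
    open FieldEmbedding ι
    private
      module KX = Poly K.rawRing
      module LX = Poly L.rawRing
    field
      algebraic : ∀ x → ∃ λ p →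
        ¬ RawRing._≈_ KX.ring p [] × LX.eval (map ⟦_⟧ p) x L.≈ L.0#
      closed    : ∀ p d a → LX.HasLeadingCoeff p d a → 0 ℕ.< d →
        ∃ λ x → LX.eval p x L.≈ L.0#

-- k is the field of fractions of K[T].

record IsRationalFunctionField {c ℓ : Level} (K k : Field c ℓ) : Set (c ⊔ ℓ) where
  private
    module K  = Field K
    module k  = Field k
    module KT = Poly K.rawRing
  field
    ⟦_⟧ : List K.Carrier → k.Carrier
    isRingMonomorphism :
      RingMorphisms.IsRingMonomorphism KT.ring k.rawRing ⟦_⟧
    fraction : ∀ x → ∃ λ a → ∃ λ b →
      ¬ RawRing._≈_ KT.ring b [] × (x k.* ⟦ b ⟧) k.≈ ⟦ a ⟧

-- 𝔽_q, k = 𝔽_q(T), an algebraic closure k̄, and k ⊂ 𝓕 ⊂ k̄.  The inclusion of k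
-- in 𝓕 is implicit in "T-module over 𝓕", which needs 𝔽_q and T in 𝓕.

record Setting (c ℓ : Level) : Set (lsuc (c ⊔ ℓ)) where
  field
    p e     : ℕ
    p-prime : Prime p

  q : ℕ
  q = p ℕ.^ e

  field
    𝔽q k k̄ 𝓕 : Field c ℓ
    order    : Inverse (setoid (Fin q)) (Field.setoid 𝔽q)
    k-frac   : IsRationalFunctionField 𝔽q k
    k⊂k̄      : FieldEmbedding k k̄
    closure  : IsAlgebraicClosure k k̄ k⊂k̄
    k⊂𝓕      : FieldEmbedding k 𝓕
    𝓕⊂k̄      : FieldEmbedding 𝓕 k̄
    tower    : ∀ x → Field._≈_ k̄
      (FieldEmbedding.⟦_⟧ 𝓕⊂k̄ (FieldEmbedding.⟦_⟧ k⊂𝓕 x))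
      (FieldEmbedding.⟦_⟧ k⊂k̄ x)

  module 𝔽q = Field 𝔽q
  module 𝓕  = Field 𝓕
  module A  = Poly 𝔽q.rawRing

  A→𝓕 : List 𝔽q.Carrier → 𝓕.Carrier
  A→𝓕 = FieldEmbedding.⟦_⟧ k⊂𝓕 ∘ IsRationalFunctionField.⟦_⟧ k-frac

  𝔽q→𝓕 : 𝔽q.Carrier → 𝓕.Carrier
  𝔽q→𝓕 x = A→𝓕 (x ∷ [])

  -- T as an element of 𝓕
  θ : 𝓕.Carrier
  θ = A→𝓕 A.X

  frob : 𝓕.Carrier → 𝓕.Carrier
  frob x = x ^ q
    where open RawSemiringDefs (RawRing.rawSemiring 𝓕.rawRing) using (_^_)

  -- 𝓕{τ}, the polynomial ring 𝓕[T], and 𝓕^{m,m}{τ}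
  module 𝓕τ = Twisted 𝓕.rawRing frob
  module 𝓕T = Poly 𝓕.rawRing
  module M (m : ℕ) = Matrix 𝓕.rawRing m
  module Mτ (m : ℕ) = Twisted (M.ring m) (λ B i j → frob (B i j))

  -- T^i in A
  T^_ : ℕ → List 𝔽q.Carrier
  T^ i = A.X ^ i
    where open RawSemiringDefs (RawRing.rawSemiring A.ring) using (_^_)

module _ {c ℓ : Level} (S : Setting c ℓ) where
  open Setting S

  record TModule (m : ℕ) : Set (c ⊔ ℓ) where
    private
      module Mat  = RawRing (M.ring m)
      module Matτ = RawRing (Mτ.ring m)
    open RawSemiringDefs Mat.rawSemiring using (_^_)
    field
      Φ : List 𝔽q.Carrier → List Mat.Carrier
      Φ-ringHom : RingMorphisms.IsRingHomomorphism A.ring (Mτ.ring m) Φ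
      Φ-linear  : ∀ x a →
        Φ (A.scale x a) Matτ.≈ Mτ.scale m (M.scalar m (𝔽q→𝓕 x)) (Φ a)

      -- Degree 0 occurs only for Φ(T) = θ I + N; such a T-module is never
      -- abelian, although all Φ(Tⁱ) then have an invertible leading coefficient.
      degree    : ℕ
      leading   : Mat.Carrier
      Φ-leading : Mτ.HasLeadingCoeff m (Φ A.X) degree leading

      N           : Mat.Carrier
      N-nilpotent : ∃ λ n → (N ^ n) Mat.≈ Mat.0#
      Φ-constant  : Mτ.coeff m (Φ A.X) 0 Mat.≈ (M.scalar m θ Mat.+ N)

  module _ {m : ℕ} (𝒜 : TModule m) where
    open TModule 𝒜
    private
      module Fτ = RawRing 𝓕τ.ring
    open RawMonoidDefs Fτ.+-rawMonoid using (sum)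

    -- f ∘ P for a row vector f ∈ 𝓕{τ}^m and P ∈ 𝓕^{m,m}{τ}, the latter read as
    -- a matrix with entries in 𝓕{τ}
    compose : Vector Fτ.Carrier m → List (M.Mat m) → Vector Fτ.Carrier m
    compose f P j = sum (λ i → f i Fτ.* map (λ B → B i j) P)

    -- (x + p T) · f = x f + p · (f ∘ Φ(T))
    act : List 𝓕.Carrier → Vector Fτ.Carrier m → Vector Fτ.Carrier m
    act []      f j = Fτ.0#
    act (x ∷ p) f j = 𝓕τ.scale x (f j) Fτ.+ act p (compose f (Φ A.X)) j

    -- Hom_𝓕(𝒜, 𝔾ₐ) = 𝓕{τ}^m as an 𝓕[T]-module
    Hom-𝔾ₐ : RawLeftModule (RawRing.Carrier 𝓕T.ring) c ℓ
    Hom-𝔾ₐ = record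
      { Carrierᴹ = Vector Fτ.Carrier m
      ; _≈ᴹ_     = λ f g → ∀ j → f j Fτ.≈ g j
      ; _+ᴹ_     = λ f g j → f j Fτ.+ g j
      ; _*ₗ_     = act
      ; 0ᴹ       = λ _ → Fτ.0#
      ; -ᴹ_      = λ f j → Fτ.- f j
      }

    -- "Finite rank" is finite generation, as in Anderson's definition.  The
    -- dimension after tensoring with 𝓕(T) is finite for every T-module (𝔾ₐ with
    -- Φ(T) = T has dimension 0), so it would not single out any class.
    IsAbelian : Set (c ⊔ ℓ)
    IsAbelian = FinitelyGenerated Hom-𝔾ₐ

    HasInvertibleLeadingCoeff : List 𝔽q.Carrier → Set (c ⊔ ℓ)
    HasInvertibleLeadingCoeff a = ∃ λ d → ∃ λ B →
      Mτ.HasLeadingCoeff m (Φ a) d B × Invertible _≈_ 1# _*_ B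
      where open RawRing (M.ring m) using (_≈_; _*_; 1#)

{-# OPTIONS --safe #-}
module Submission where

-- Let d be the degree of Φ(Tⁱ) and B its invertible leading coefficient.  If
-- d > 0, division on the right by Φ(Tⁱ) works in 𝓕{τ}^m: a row vector with
-- leading term v τⁿ, n ≥ d, agrees up to lower order with
-- (v σⁿ⁻ᵈ(B⁻¹) τⁿ⁻ᵈ) ∘ Φ(Tⁱ), where σ is the entrywise Frobenius.  Hence the m d
-- vectors e_j τⁿ with n < d generate 𝓕{τ}^m over 𝓕[T].
--
-- The case d = 0 cannot occur.  If Φ(Tⁱ) = B were constant, then B = a₀ⁱ would
-- satisfy B aₙ = aₙ σⁿ(B) for the leading coefficient aₙ of Φ(T), because Φ(T)
-- and Φ(Tⁱ) commute.  But θⁱ is the only eigenvalue of B, that of σⁿ(B) is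
-- θ^(i qⁿ) ≠ θⁱ, and so aₙ = 0.

open import Defs
open import Data.Nat.Base using (ℕ; _<_)
open import Data.Product.Base using (∃; _×_)

open import Algebra.Bundles using (CommutativeMonoid; CommutativeRing; Monoid; Ring)
open import Algebra.Bundles.Raw using (RawMonoid; RawRing)
import Algebra.Construct.Pointwise as Pointwise
import Algebra.Definitions.RawMonoid as RawMonoidDefs
open import Algebra.Morphism.Construct.Composition using (isRingMonomorphism)
open import Algebra.Morphism.Structures using (module RingMorphisms)
import Algebra.Properties.AbelianGroup as AbelianGroupProperties
import Algebra.Properties.CommutativeMonoid.Sum as CommutativeMonoidSum
import Algebra.Properties.CommutativeSemigroup as CommutativeSemigroupProperties
import Algebra.Properties.CommutativeSemiring.Binomial as Binomial
import Algebra.Properties.CommutativeSemiring.Exp as CommutativeSemiringExp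
import Algebra.Properties.Ring as RingProperties
import Algebra.Properties.Semiring.Exp as SemiringExp
import Algebra.Properties.Semiring.Mult as SemiringMult
import Algebra.Properties.Semiring.Sum as SemiringSum
open import Data.Bool.Base using (if_then_else_; true; false)
open import Data.Empty using (⊥-elim)
open import Data.Fin.Base using (Fin; zero; suc; toℕ; fromℕ; fromℕ<; inject₁; combine; remQuot)
open import Data.Fin.Permutation using (permutation)
open import Data.Fin.Properties
  using (_≟_; suc-injective; toℕ-fromℕ; toℕ-fromℕ<; toℕ-inject₁; toℕ<n; remQuot-combine)
open import Data.List.Base using (List; []; _∷_; length; map)
open import Data.List.Properties using (map-id; map-∘)
open import Data.Nat.Base as ℕ using (zero; suc; _!)
open import Data.Nat.Combinatorics using (_C_; nCn≡1; k![n∸k]!∣n!)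
open import Data.Nat.Combinatorics.Specification using (nCk≡n!/k![n-k]!)
open import Data.Nat.DivMod using (m/n*n≡m)
open import Data.Nat.Divisibility using (_∣_; divides; ∣⇒≤; m∣m*n; ∣1⇒≡1)
open import Data.Nat.GeneralisedArithmetic using (iterate)
open import Data.Nat.Induction using (<-rec)
open import Data.Nat.Primality using (Prime; euclidsLemma; prime⇒nonTrivial; prime⇒nonZero)
import Data.Nat.Properties as ℕ
open import Data.Product.Base using (_,_; proj₁; proj₂)
open import Data.Sum.Base using (_⊎_; inj₁; inj₂)
open import Data.Vec.Functional using (Vector)
open import Function.Base using (_∘_; id)
open import Function.Bundles using (Inverse)
open import Level using (Level; _⊔_)
import Relation.Binary.Reasoning.Setoid as SetoidReasoning
open import Relation.Binary.PropositionalEquality as ≡ using (_≡_; _≢_)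
open import Relation.Nullary.Decidable.Core using (does; yes; no)
open import Relation.Nullary.Negation.Core using (¬_; contradiction)

-- The hypothesis `0 < degree` makes n > 0 in the exclusion of d = 0; for Φ(T) = θ I + N every Φ(Tⁱ)
-- is constant. The eigenvalue argument there is run without eigenvalues. Both a₀ = θ I + N and
-- σⁿ(a₀) = θ^(qⁿ) I + σⁿ(N) are a scalar plus a nilpotent matrix, so an induction on the two
-- nilpotency exponents reduces B x = x σⁿ(B) to an x killed by N on the left and by σⁿ(N) on the
-- right. For such x the relation reads θⁱ x = θ^(i qⁿ) x. Two facts about the setting support this:
-- σ is additive, because a field with p^e elements forces p = 0 in 𝓕, and the powers of θ are
-- distinct, because T is transcendental over 𝔽q and q > 1. In the division, equality in 𝓕 is not
-- assumed decidable, so the degree of a vector cannot be computed. Upper bounds replace degrees,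
-- and the coefficient that is removed may be zero. Since d > 0, the quotient has a smaller bound
-- than the dividend, which is why an induction can place it in the span first.

private
  variable
    a ℓ b ℓ′ : Level

-- Finite sums in monoids.

module _ (M : CommutativeMonoid a ℓ) where
  open CommutativeMonoid M
  open CommutativeMonoidSum M using (sum; sum-cong-≋; sum-replicate-zero)

  sum-zero : ∀ {n} (t : Vector Carrier n) → (∀ i → t i ≈ ε) → sum t ≈ ε
  sum-zero {n} t t≈0 = trans (sum-cong-≋ t≈0) (sum-replicate-zero n)

  sum-single : ∀ {n} (t : Vector Carrier n) k → (∀ i → i ≢ k → t i ≈ ε) → sum t ≈ t k
  sum-single t zero    off = trans (∙-congˡ (sum-zero (t ∘ suc) (λ i → off (suc i) λ ()))) (identityʳ _)
  sum-single t (suc k) off = trans (∙-cong (off zero λ ())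
    (sum-single (t ∘ suc) k (λ i i≢k → off (suc i) (i≢k ∘ suc-injective)))) (identityˡ _)

module _ (M : RawMonoid a ℓ) (N : Monoid b ℓ′) where
  private
    module M = RawMonoid M
    module N = Monoid N
  open RawMonoidDefs

  -- The source is a raw monoid because the sums in the definitions of `compose` and of finite
  -- generation are taken in raw structures. Typical h are the extraction of a coefficient, the
  -- Frobenius and composition with a fixed Φ(a).
  sum-homo : (h : M.Carrier → N.Carrier) → h M.ε N.≈ N.ε →
             (∀ x y → h (x M.∙ y) N.≈ h x N.∙ h y) →
             ∀ {n} (v : Vector M.Carrier n) → h (sum M v) N.≈ sum N.rawMonoid (h ∘ v)
  sum-homo h h-ε h-∙ {zero}  v = h-ε
  sum-homo h h-ε h-∙ {suc n} v =
    N.trans (h-∙ _ _) (N.∙-congˡ (sum-homo h h-ε h-∙ (v ∘ suc)))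

-- Matrices over a possibly noncommutative ring, such as 𝓕 or 𝓕{τ}.

module MatrixRing (R : Ring a ℓ) (m : ℕ) where
  open Ring R
  open SemiringSum semiring
  open Matrix rawRing m using (Mat; scalar) renaming (ring to rawMatrixRing)
  open SetoidReasoning setoid

  -- Stated for a single row, it serves three times: as associativity of the matrix product, over
  -- 𝓕{τ} as associativity of composition of row vectors, and in the division to regroup (v σᵏ(B⁻¹))
  -- σᵏ(B).
  row-assoc : (f : Vector Carrier m) (M N : Mat) (j : Fin m) →
              sum (λ l → sum (λ i → f i * M i l) * N l j) ≈
              sum (λ i → f i * sum (λ l → M i l * N l j))
  row-assoc f M N j = begin
    sum (λ l → sum (λ i → f i * M i l) * N l j)   ≈⟨ sum-cong-≋ (λ l → *-distribʳ-sum (N l j) (λ i → f i * M i l)) ⟩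
    sum (λ l → sum (λ i → f i * M i l * N l j))   ≈⟨ ∑-comm (λ l i → f i * M i l * N l j) ⟩
    sum (λ i → sum (λ l → f i * M i l * N l j))   ≈⟨ sum-cong-≋ (λ i → sum-cong-≋ (λ l → *-assoc (f i) (M i l) (N l j))) ⟩
    sum (λ i → sum (λ l → f i * (M i l * N l j))) ≈⟨ sum-cong-≋ (λ i → *-distribˡ-sum (f i) (λ l → M i l * N l j)) ⟨
    sum (λ i → f i * sum (λ l → M i l * N l j))   ∎

  scalar-diagonal : ∀ x i → scalar x i i ≈ x
  scalar-diagonal x i with i ≟ i
  ... | yes _  = refl
  ... | no i≢i = ⊥-elim (i≢i ≡.refl)

  scalar-off : ∀ x {i j} → i ≢ j → scalar x i j ≈ 0#
  scalar-off x {i} {j} i≢j with i ≟ j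
  ... | yes i≡j = ⊥-elim (i≢j i≡j)
  ... | no  _   = refl

  row-scalar : ∀ (f : Vector Carrier m) x j → sum (λ i → f i * scalar x i j) ≈ f j * x
  row-scalar f x j = trans
    (sum-single +-commutativeMonoid _ j (λ i i≢j → trans (*-congˡ (scalar-off x i≢j)) (zeroʳ _)))
    (*-congˡ (scalar-diagonal x j))

  scalar-column : ∀ (f : Vector Carrier m) x i → sum (λ l → scalar x i l * f l) ≈ x * f i
  scalar-column f x i = trans
    (sum-single +-commutativeMonoid _ i (λ l l≢i → trans (*-congʳ (scalar-off x (l≢i ∘ ≡.sym))) (zeroˡ _)))
    (*-congʳ (scalar-diagonal x i))

  matrixRing : Ring _ _
  matrixRing = record
    { RawRing rawMatrixRing
    ; isRing = record
      { +-isAbelianGroup = record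
        { isGroup = record
          { isMonoid = record
            { isSemigroup = record
              { isMagma = record
                { isEquivalence = record
                  { refl  = λ _ _ → refl
                  ; sym   = λ p i j → sym (p i j)
                  ; trans = λ p q i j → trans (p i j) (q i j)
                  }
                ; ∙-cong = λ p q i j → +-cong (p i j) (q i j)
                }
              ; assoc = λ _ _ _ _ _ → +-assoc _ _ _
              }
            ; identity = (λ _ _ _ → +-identityˡ _) , (λ _ _ _ → +-identityʳ _)
            }
          ; inverse = (λ _ _ _ → -‿inverseˡ _) , (λ _ _ _ → -‿inverseʳ _)
          ; ⁻¹-cong = λ p i j → -‿cong (p i j)
          }
        ; comm = λ _ _ _ _ → +-comm _ _
        }
      ; *-cong     = λ p q i j → sum-cong-≋ (λ l → *-cong (p i l) (q l j))
      ; *-assoc    = λ M N P i → row-assoc (M i) N P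
      ; *-identity = (λ M i j → trans (scalar-column (λ l → M l j) 1# i) (*-identityˡ _))
                   , (λ M i j → trans (row-scalar (M i) 1# j) (*-identityʳ _))
      ; distrib    = (λ M N P i j → trans (sum-cong-≋ (λ l → distribˡ (M i l) (N l j) (P l j))) (∑-distrib-+ (λ l → M i l * N l j) _))
                   , (λ M N P i j → trans (sum-cong-≋ (λ l → distribʳ (M l j) (N i l) (P i l))) (∑-distrib-+ (λ l → N i l * M l j) _))
      }
    }

-- Ring endomorphisms and their iterates.

module RingEndo (R : Ring a ℓ) where
  open Ring R
  open RingMorphisms rawRing rawRing
  open AbelianGroupProperties +-abelianGroup using (identityʳ-unique; inverseʳ-unique)

  -- Additivity alone settles zero and negatives, by cancellation in the additive group.
  mkEndo : ∀ σ → (∀ {x y} → x ≈ y → σ x ≈ σ y) →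
           (∀ x y → σ (x + y) ≈ σ x + σ y) → (∀ x y → σ (x * y) ≈ σ x * σ y) →
           σ 1# ≈ 1# → IsRingHomomorphism σ
  mkEndo σ σ-cong σ-+ σ-* σ-1 = record
    { isSemiringHomomorphism = record
      { isNearSemiringHomomorphism = record
        { +-isMonoidHomomorphism = record
          { isMagmaHomomorphism = record
            { isRelHomomorphism = record { cong = σ-cong }
            ; homo = σ-+
            }
          ; ε-homo = σ-0
          }
        ; *-homo = σ-*
        }
      ; 1#-homo = σ-1
      }
    ; -‿homo = λ x → inverseʳ-unique _ _
        (trans (sym (σ-+ x (- x))) (trans (σ-cong (-‿inverseʳ x)) σ-0))
    }
    where
    σ-0 : σ 0# ≈ 0#
    σ-0 = identityʳ-unique (σ 0#) (σ 0#) (trans (sym (σ-+ 0# 0#)) (σ-cong (+-identityʳ 0#)))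

  iterate-homo : ∀ {σ} → IsRingHomomorphism σ → ∀ n → IsRingHomomorphism (λ x → iterate σ x n)
  iterate-homo σ-hom zero    = mkEndo id id (λ _ _ → refl) (λ _ _ → refl) refl
  iterate-homo {σ} σ-hom (suc n) = mkEndo _ (S.⟦⟧-cong ∘ H.⟦⟧-cong)
    (λ x y → trans (S.⟦⟧-cong (H.+-homo x y)) (S.+-homo _ _))
    (λ x y → trans (S.⟦⟧-cong (H.*-homo x y)) (S.*-homo _ _))
    (trans (S.⟦⟧-cong H.1#-homo) S.1#-homo)
    where
    module H = IsRingHomomorphism σ-hom
    module S = IsRingHomomorphism (iterate-homo σ-hom n)

-- Twisted polynomials, used for 𝔽q[T] (σ the identity), 𝓕{τ} and 𝓕^{m,m}{τ}.

module TwistedRing (R : Ring a ℓ) {σ : Ring.Carrier R → Ring.Carrier R}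
  (σ-hom : RingMorphisms.IsRingHomomorphism (Ring.rawRing R) (Ring.rawRing R) σ) where
  open Ring R
  open Twisted rawRing σ renaming (ring to rawTwistedRing)
  open SetoidReasoning setoid
  open CommutativeSemigroupProperties
    (CommutativeMonoid.commutativeSemigroup +-commutativeMonoid) using (interchange)
  private
    module σ = RingMorphisms.IsRingHomomorphism σ-hom

  infix 4 _≋_
  _≋_ : List Carrier → List Carrier → Set ℓ
  p ≋ q = ∀ n → coeff p n ≈ coeff q n

  coeff-+ : ∀ p q n → coeff (p +ₚ q) n ≈ coeff p n + coeff q n
  coeff-+ []      q       n       = sym (+-identityˡ _)
  coeff-+ (x ∷ p) []      n       = sym (+-identityʳ _)
  coeff-+ (x ∷ p) (y ∷ q) zero    = refl
  coeff-+ (x ∷ p) (y ∷ q) (suc n) = coeff-+ p q n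

  coeff-scale : ∀ x p n → coeff (scale x p) n ≈ x * coeff p n
  coeff-scale x []      n       = sym (zeroʳ x)
  coeff-scale x (y ∷ p) zero    = refl
  coeff-scale x (y ∷ p) (suc n) = coeff-scale x p n

  coeff-neg : ∀ p n → coeff (map -_ p) n ≈ - coeff p n
  coeff-neg []      n       = sym (AbelianGroupProperties.ε⁻¹≈ε +-abelianGroup)
  coeff-neg (y ∷ p) zero    = refl
  coeff-neg (y ∷ p) (suc n) = coeff-neg p n

  coeff-σ : ∀ p n → coeff (map σ p) n ≈ σ (coeff p n)
  coeff-σ []      n       = sym σ.0#-homo
  coeff-σ (x ∷ p) zero    = refl
  coeff-σ (x ∷ p) (suc n) = coeff-σ p n

  shift-cong : ∀ p q → p ≋ q → (0# ∷ p) ≋ (0# ∷ q)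
  shift-cong p q p≋q zero    = refl
  shift-cong p q p≋q (suc n) = p≋q n

  shift-0 : ∀ p → p ≋ [] → (0# ∷ p) ≋ []
  shift-0 p p≋0 zero    = refl
  shift-0 p p≋0 (suc n) = p≋0 n

  coeff-shift-+ : ∀ p q n → coeff (0# ∷ (p +ₚ q)) n ≈ coeff (0# ∷ p) n + coeff (0# ∷ q) n
  coeff-shift-+ p q zero    = sym (+-identityˡ _)
  coeff-shift-+ p q (suc n) = coeff-+ p q n

  +ₚ-cong : ∀ p p′ q q′ → p ≋ p′ → q ≋ q′ → (p +ₚ q) ≋ (p′ +ₚ q′)
  +ₚ-cong p p′ q q′ p≋ q≋ n = begin
    coeff (p +ₚ q) n          ≈⟨ coeff-+ p q n ⟩
    coeff p n + coeff q n     ≈⟨ +-cong (p≋ n) (q≋ n) ⟩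
    coeff p′ n + coeff q′ n   ≈⟨ coeff-+ p′ q′ n ⟨
    coeff (p′ +ₚ q′) n        ∎

  σ-cong : ∀ p q → p ≋ q → map σ p ≋ map σ q
  σ-cong p q p≋q n = trans (coeff-σ p n) (trans (σ.⟦⟧-cong (p≋q n)) (sym (coeff-σ q n)))

  coeff-∷-* : ∀ x p q n →
              coeff ((x ∷ p) *ₚ q) n ≈ x * coeff q n + coeff (0# ∷ (p *ₚ map σ q)) n
  coeff-∷-* x p q n = trans (coeff-+ (scale x q) _ n) (+-congʳ (coeff-scale x q n))

  *ₚ-congˡ : ∀ p q q′ → q ≋ q′ → (p *ₚ q) ≋ (p *ₚ q′)
  *ₚ-congˡ []      q q′ q≋ n = refl
  *ₚ-congˡ (x ∷ p) q q′ q≋ n = begin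
    coeff ((x ∷ p) *ₚ q) n                             ≈⟨ coeff-∷-* x p q n ⟩
    x * coeff q n + coeff (0# ∷ (p *ₚ map σ q)) n      ≈⟨ +-cong (*-congˡ (q≋ n))
      (shift-cong _ _ (*ₚ-congˡ p _ _ (σ-cong q q′ q≋)) n) ⟩
    x * coeff q′ n + coeff (0# ∷ (p *ₚ map σ q′)) n    ≈⟨ coeff-∷-* x p q′ n ⟨
    coeff ((x ∷ p) *ₚ q′) n                            ∎

  -- A list that represents zero may be non-empty; this absorbs the trailing zeros when `*ₚ-congʳ`
  -- compares lists of different lengths.
  *ₚ-zeroˡ : ∀ p q → p ≋ [] → (p *ₚ q) ≋ []
  *ₚ-zeroˡ []      q p≋0 n = refl
  *ₚ-zeroˡ (x ∷ p) q p≋0 n = begin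
    coeff ((x ∷ p) *ₚ q) n                         ≈⟨ coeff-∷-* x p q n ⟩
    x * coeff q n + coeff (0# ∷ (p *ₚ map σ q)) n  ≈⟨ +-cong (trans (*-congʳ (p≋0 0)) (zeroˡ _))
      (shift-0 _ (*ₚ-zeroˡ p _ (p≋0 ∘ suc)) n) ⟩
    0# + 0#                                        ≈⟨ +-identityˡ _ ⟩
    0#                                             ∎

  *ₚ-congʳ : ∀ p p′ q → p ≋ p′ → (p *ₚ q) ≋ (p′ *ₚ q)
  *ₚ-congʳ []      p′       q p≋ n = sym (*ₚ-zeroˡ p′ q (sym ∘ p≋) n)
  *ₚ-congʳ (x ∷ p) []       q p≋ n = *ₚ-zeroˡ (x ∷ p) q p≋ n
  *ₚ-congʳ (x ∷ p) (y ∷ p′) q p≋ n = begin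
    coeff ((x ∷ p) *ₚ q) n                         ≈⟨ coeff-∷-* x p q n ⟩
    x * coeff q n + coeff (0# ∷ (p *ₚ map σ q)) n  ≈⟨ +-cong (*-congʳ (p≋ 0))
      (shift-cong _ _ (*ₚ-congʳ p p′ _ (p≋ ∘ suc)) n) ⟩
    y * coeff q n + coeff (0# ∷ (p′ *ₚ map σ q)) n ≈⟨ coeff-∷-* y p′ q n ⟨
    coeff ((y ∷ p′) *ₚ q) n                        ∎

  *ₚ-distribʳ : ∀ q p p′ → ((p +ₚ p′) *ₚ q) ≋ (p *ₚ q +ₚ p′ *ₚ q)
  *ₚ-distribʳ q []      p′       n = refl
  *ₚ-distribʳ q (x ∷ p) []       n = sym (trans (coeff-+ ((x ∷ p) *ₚ q) [] n) (+-identityʳ _))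
  *ₚ-distribʳ q (x ∷ p) (y ∷ p′) n = begin
    coeff ((x + y ∷ p +ₚ p′) *ₚ q) n
      ≈⟨ coeff-∷-* (x + y) (p +ₚ p′) q n ⟩
    (x + y) * coeff q n + coeff (0# ∷ ((p +ₚ p′) *ₚ map σ q)) n
      ≈⟨ +-cong (distribʳ _ _ _) (trans (shift-cong _ _ (*ₚ-distribʳ (map σ q) p p′) n)
           (coeff-shift-+ (p *ₚ map σ q) (p′ *ₚ map σ q) n)) ⟩
    (x * coeff q n + y * coeff q n) + (coeff (0# ∷ (p *ₚ map σ q)) n + coeff (0# ∷ (p′ *ₚ map σ q)) n)
      ≈⟨ interchange _ _ _ _ ⟩
    (x * coeff q n + coeff (0# ∷ (p *ₚ map σ q)) n) + (y * coeff q n + coeff (0# ∷ (p′ *ₚ map σ q)) n)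
      ≈⟨ +-cong (coeff-∷-* x p q n) (coeff-∷-* y p′ q n) ⟨
    coeff ((x ∷ p) *ₚ q) n + coeff ((y ∷ p′) *ₚ q) n
      ≈⟨ coeff-+ ((x ∷ p) *ₚ q) _ n ⟨
    coeff ((x ∷ p) *ₚ q +ₚ (y ∷ p′) *ₚ q) n ∎

  σ-+ₚ : ∀ p q → map σ (p +ₚ q) ≋ (map σ p +ₚ map σ q)
  σ-+ₚ p q n = begin
    coeff (map σ (p +ₚ q)) n                    ≈⟨ coeff-σ (p +ₚ q) n ⟩
    σ (coeff (p +ₚ q) n)                        ≈⟨ σ.⟦⟧-cong (coeff-+ p q n) ⟩
    σ (coeff p n + coeff q n)                   ≈⟨ σ.+-homo _ _ ⟩
    σ (coeff p n) + σ (coeff q n)               ≈⟨ +-cong (coeff-σ p n) (coeff-σ q n) ⟨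
    coeff (map σ p) n + coeff (map σ q) n       ≈⟨ coeff-+ (map σ p) _ n ⟨
    coeff (map σ p +ₚ map σ q) n                ∎

  *ₚ-distribˡ : ∀ p q q′ → (p *ₚ (q +ₚ q′)) ≋ (p *ₚ q +ₚ p *ₚ q′)
  *ₚ-distribˡ []      q q′ n = refl
  *ₚ-distribˡ (x ∷ p) q q′ n = begin
    coeff ((x ∷ p) *ₚ (q +ₚ q′)) n
      ≈⟨ coeff-∷-* x p (q +ₚ q′) n ⟩
    x * coeff (q +ₚ q′) n + coeff (0# ∷ (p *ₚ map σ (q +ₚ q′))) n
      ≈⟨ +-cong (trans (*-congˡ (coeff-+ q q′ n)) (distribˡ _ _ _))
           (trans (shift-cong _ _ (λ k → trans (*ₚ-congˡ p _ _ (σ-+ₚ q q′) k) (*ₚ-distribˡ p (map σ q) (map σ q′) k)) n)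
           (coeff-shift-+ (p *ₚ map σ q) (p *ₚ map σ q′) n)) ⟩
    (x * coeff q n + x * coeff q′ n) + (coeff (0# ∷ (p *ₚ map σ q)) n + coeff (0# ∷ (p *ₚ map σ q′)) n)
      ≈⟨ interchange _ _ _ _ ⟩
    (x * coeff q n + coeff (0# ∷ (p *ₚ map σ q)) n) + (x * coeff q′ n + coeff (0# ∷ (p *ₚ map σ q′)) n)
      ≈⟨ +-cong (coeff-∷-* x p q n) (coeff-∷-* x p q′ n) ⟨
    coeff ((x ∷ p) *ₚ q) n + coeff ((x ∷ p) *ₚ q′) n
      ≈⟨ coeff-+ ((x ∷ p) *ₚ q) _ n ⟨
    coeff ((x ∷ p) *ₚ q +ₚ (x ∷ p) *ₚ q′) n ∎

  scale-*ₚ : ∀ x p q → (scale x p *ₚ q) ≋ scale x (p *ₚ q)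
  scale-*ₚ x []      q n = refl
  scale-*ₚ x (y ∷ p) q n = begin
    coeff (scale x (y ∷ p) *ₚ q) n
      ≈⟨ coeff-∷-* (x * y) (scale x p) q n ⟩
    x * y * coeff q n + coeff (0# ∷ (scale x p *ₚ map σ q)) n
      ≈⟨ +-cong (*-assoc _ _ _) (shift n) ⟩
    x * (y * coeff q n) + x * coeff (0# ∷ (p *ₚ map σ q)) n
      ≈⟨ distribˡ _ _ _ ⟨
    x * (y * coeff q n + coeff (0# ∷ (p *ₚ map σ q)) n)
      ≈⟨ *-congˡ (coeff-∷-* y p q n) ⟨
    x * coeff ((y ∷ p) *ₚ q) n
      ≈⟨ coeff-scale x ((y ∷ p) *ₚ q) n ⟨
    coeff (scale x ((y ∷ p) *ₚ q)) n ∎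
    where
    shift : ∀ n → coeff (0# ∷ (scale x p *ₚ map σ q)) n ≈ x * coeff (0# ∷ (p *ₚ map σ q)) n
    shift zero    = sym (zeroʳ x)
    shift (suc n) = trans (scale-*ₚ x p (map σ q) n) (coeff-scale x (p *ₚ map σ q) n)

  shift-*ₚ : ∀ p q → ((0# ∷ p) *ₚ q) ≋ (0# ∷ (p *ₚ map σ q))
  shift-*ₚ p q n = trans (coeff-∷-* 0# p q n) (trans (+-congʳ (zeroˡ _)) (+-identityˡ _))

  σ-*ₚ : ∀ p q → map σ (p *ₚ q) ≋ (map σ p *ₚ map σ q)
  σ-*ₚ []      q n = refl
  σ-*ₚ (x ∷ p) q n = begin
    coeff (map σ ((x ∷ p) *ₚ q)) n                                   ≈⟨ coeff-σ ((x ∷ p) *ₚ q) n ⟩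
    σ (coeff ((x ∷ p) *ₚ q) n)                                       ≈⟨ σ.⟦⟧-cong (coeff-∷-* x p q n) ⟩
    σ (x * coeff q n + coeff (0# ∷ (p *ₚ map σ q)) n)                ≈⟨ σ.+-homo _ _ ⟩
    σ (x * coeff q n) + σ (coeff (0# ∷ (p *ₚ map σ q)) n)            ≈⟨ +-cong
      (trans (σ.*-homo _ _) (*-congˡ (sym (coeff-σ q n)))) (shift n) ⟩
    σ x * coeff (map σ q) n + coeff (0# ∷ (map σ p *ₚ map σ (map σ q))) n  ≈⟨ coeff-∷-* (σ x) (map σ p) (map σ q) n ⟨
    coeff (map σ (x ∷ p) *ₚ map σ q) n                               ∎
    where
    shift : ∀ n → σ (coeff (0# ∷ (p *ₚ map σ q)) n) ≈ coeff (0# ∷ (map σ p *ₚ map σ (map σ q))) n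
    shift zero    = σ.0#-homo
    shift (suc n) = trans (sym (coeff-σ (p *ₚ map σ q) n)) (σ-*ₚ p (map σ q) n)

  -- Split the left factor as x + p τ. The part x is linearity, and in the other part τ (q r) = σ(q)
  -- σ(r) τ, where multiplicativity of σ on polynomials (`σ-*ₚ`) enters.
  *ₚ-assoc : ∀ p q r → (p *ₚ q *ₚ r) ≋ (p *ₚ (q *ₚ r))
  *ₚ-assoc []      q r n = refl
  *ₚ-assoc (x ∷ p) q r n = begin
    coeff ((x ∷ p) *ₚ q *ₚ r) n
      ≈⟨ *ₚ-distribʳ r (scale x q) (0# ∷ (p *ₚ map σ q)) n ⟩
    coeff (scale x q *ₚ r +ₚ (0# ∷ (p *ₚ map σ q)) *ₚ r) n
      ≈⟨ +ₚ-cong (scale x q *ₚ r) (scale x (q *ₚ r)) ((0# ∷ (p *ₚ map σ q)) *ₚ r) (0# ∷ (p *ₚ map σ (q *ₚ r))) (scale-*ₚ x q r) (λ k →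
           trans (shift-*ₚ (p *ₚ map σ q) r k)
           (shift-cong _ _ (λ l → trans (*ₚ-assoc p (map σ q) (map σ r) l)
             (sym (*ₚ-congˡ p _ _ (σ-*ₚ q r) l))) k)) n ⟩
    coeff (scale x (q *ₚ r) +ₚ (0# ∷ (p *ₚ map σ (q *ₚ r)))) n ∎

  *ₚ-identityˡ : ∀ q → ((1# ∷ []) *ₚ q) ≋ q
  *ₚ-identityˡ q n = begin
    coeff ((1# ∷ []) *ₚ q) n             ≈⟨ coeff-∷-* 1# [] q n ⟩
    1# * coeff q n + coeff (0# ∷ []) n   ≈⟨ +-cong (*-identityˡ _) (shift-0 [] (λ _ → refl) n) ⟩
    coeff q n + 0#                       ≈⟨ +-identityʳ _ ⟩
    coeff q n                            ∎

  *ₚ-identityʳ : ∀ p → (p *ₚ (1# ∷ [])) ≋ p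
  *ₚ-identityʳ []      n       = refl
  *ₚ-identityʳ (x ∷ p) zero    = trans (+-identityʳ _) (*-identityʳ x)
  *ₚ-identityʳ (x ∷ p) (suc n) =
    trans (*ₚ-congˡ p (σ 1# ∷ []) (1# ∷ []) σ1 n) (*ₚ-identityʳ p n)
    where
    σ1 : (σ 1# ∷ []) ≋ (1# ∷ [])
    σ1 zero    = σ.1#-homo
    σ1 (suc n) = refl

  twistedRing : Ring _ _
  twistedRing = record
    { RawRing rawTwistedRing
    ; isRing = record
      { +-isAbelianGroup = record
        { isGroup = record
          { isMonoid = record
            { isSemigroup = record
              { isMagma = record
                { isEquivalence = record
                  { refl  = λ _ → refl
                  ; sym   = λ p n → sym (p n)
                  ; trans = λ p q n → trans (p n) (q n)
                  }
                ; ∙-cong = λ {p} {p′} {q} {q′} → +ₚ-cong p p′ q q′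
                }
              ; assoc = λ p q r n → begin
                  coeff (p +ₚ q +ₚ r) n               ≈⟨ coeff-+ (p +ₚ q) r n ⟩
                  coeff (p +ₚ q) n + coeff r n        ≈⟨ +-congʳ (coeff-+ p q n) ⟩
                  coeff p n + coeff q n + coeff r n   ≈⟨ +-assoc _ _ _ ⟩
                  coeff p n + (coeff q n + coeff r n) ≈⟨ +-congˡ (coeff-+ q r n) ⟨
                  coeff p n + coeff (q +ₚ r) n        ≈⟨ coeff-+ p (q +ₚ r) n ⟨
                  coeff (p +ₚ (q +ₚ r)) n             ∎
              }
            ; identity = (λ _ _ → refl) , (λ p n → trans (coeff-+ p [] n) (+-identityʳ _))
            }
          ; inverse = (λ p n → trans (coeff-+ (map -_ p) p n) (trans (+-congʳ (coeff-neg p n)) (-‿inverseˡ _)))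
                    , (λ p n → trans (coeff-+ p (map -_ p) n) (trans (+-congˡ (coeff-neg p n)) (-‿inverseʳ _)))
          ; ⁻¹-cong = λ {p} {q} p≋q n → trans (coeff-neg p n) (trans (-‿cong (p≋q n)) (sym (coeff-neg q n)))
          }
        ; comm = λ p q n → trans (coeff-+ p q n) (trans (+-comm _ _) (sym (coeff-+ q p n)))
        }
      ; *-cong     = λ {p} {p′} {q} {q′} p≋ q≋ n → trans (*ₚ-congʳ p p′ q p≋ n) (*ₚ-congˡ p′ q q′ q≋ n)
      ; *-assoc    = *ₚ-assoc
      ; *-identity = *ₚ-identityˡ , *ₚ-identityʳ
      ; distrib    = *ₚ-distribˡ , *ₚ-distribʳ
      }
    }

  mono : Carrier → ℕ → List Carrier
  mono x zero    = x ∷ []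
  mono x (suc k) = 0# ∷ mono x k

  coeff-mono-≡ : ∀ x k → coeff (mono x k) k ≈ x
  coeff-mono-≡ x zero    = refl
  coeff-mono-≡ x (suc k) = coeff-mono-≡ x k

  coeff-mono-≢ : ∀ x k n → k ≢ n → coeff (mono x k) n ≈ 0#
  coeff-mono-≢ x zero    zero    k≢n = contradiction ≡.refl k≢n
  coeff-mono-≢ x zero    (suc n) k≢n = refl
  coeff-mono-≢ x (suc k) zero    k≢n = refl
  coeff-mono-≢ x (suc k) (suc n) k≢n = coeff-mono-≢ x k n (k≢n ∘ ≡.cong suc)

  -- Only the term b τⁿ of q reaches degree k + n, through (x τᵏ)(b τⁿ) = x σᵏ(b) τᵏ⁺ⁿ.
  coeff-mono-* : ∀ x k q n → coeff (mono x k *ₚ q) (k ℕ.+ n) ≈ x * iterate σ (coeff q n) k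
  coeff-mono-* x zero    q n = begin
    coeff ((x ∷ []) *ₚ q) n             ≈⟨ coeff-∷-* x [] q n ⟩
    x * coeff q n + coeff (0# ∷ []) n   ≈⟨ +-congˡ (shift-0 [] (λ _ → refl) n) ⟩
    x * coeff q n + 0#                  ≈⟨ +-identityʳ _ ⟩
    x * coeff q n                       ∎
  coeff-mono-* x (suc k) q n = begin
    coeff ((0# ∷ mono x k) *ₚ q) (suc (k ℕ.+ n))   ≈⟨ shift-*ₚ (mono x k) q (suc (k ℕ.+ n)) ⟩
    coeff (mono x k *ₚ map σ q) (k ℕ.+ n)          ≈⟨ coeff-mono-* x k (map σ q) n ⟩
    x * iterate σ (coeff (map σ q) n) k            ≈⟨ *-congˡ (Iter.⟦⟧-cong (coeff-σ q n)) ⟩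
    x * iterate σ (σ (coeff q n)) k                ∎
    where module Iter = RingMorphisms.IsRingHomomorphism (RingEndo.iterate-homo R σ-hom k)

  coeff-*-0 : ∀ p q → coeff (p *ₚ q) 0 ≈ coeff p 0 * coeff q 0
  coeff-*-0 []      q = sym (zeroˡ _)
  coeff-*-0 (x ∷ p) q = trans (coeff-∷-* x p q 0) (+-identityʳ _)

  coeff-constant-* : ∀ p q → (∀ n → coeff p (suc n) ≈ 0#) →
                     ∀ n → coeff (p *ₚ q) n ≈ coeff p 0 * coeff q n
  coeff-constant-* []      q p>0 n = sym (zeroˡ _)
  coeff-constant-* (x ∷ p) q p>0 n = trans (coeff-∷-* x p q n)
    (trans (+-congˡ (shift-0 _ (*ₚ-zeroˡ p _ p>0) n)) (+-identityʳ _))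

  -- A constant b on the right is twisted, since τⁿ b = σⁿ(b) τⁿ, while `coeff-constant-*` leaves a
  -- constant on the left alone. This asymmetry is the source of the intertwining relation for the
  -- leading coefficient of Φ(T).
  coeff-*-constant : ∀ p q → (∀ n → coeff q (suc n) ≈ 0#) →
                     ∀ n → coeff (p *ₚ q) n ≈ coeff p n * iterate σ (coeff q 0) n
  coeff-*-constant []      q q>0 n       = sym (zeroˡ _)
  coeff-*-constant (x ∷ p) q q>0 zero    = coeff-*-0 (x ∷ p) q
  coeff-*-constant (x ∷ p) q q>0 (suc n) = begin
    coeff ((x ∷ p) *ₚ q) (suc n)                      ≈⟨ coeff-∷-* x p q (suc n) ⟩
    x * coeff q (suc n) + coeff (p *ₚ map σ q) n      ≈⟨ +-congʳ (trans (*-congˡ (q>0 n)) (zeroʳ x)) ⟩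
    0# + coeff (p *ₚ map σ q) n                       ≈⟨ +-identityˡ _ ⟩
    coeff (p *ₚ map σ q) n                            ≈⟨ coeff-*-constant p (map σ q)
      (λ k → trans (coeff-σ q (suc k)) (trans (σ.⟦⟧-cong (q>0 k)) σ.0#-homo)) n ⟩
    coeff p n * iterate σ (coeff (map σ q) 0) n       ≈⟨ *-congˡ (Iter.⟦⟧-cong (coeff-σ q 0)) ⟩
    coeff p n * iterate σ (σ (coeff q 0)) n           ∎
    where module Iter = RingMorphisms.IsRingHomomorphism (RingEndo.iterate-homo R σ-hom n)

  coeff-sum : ∀ {m} (v : Vector (List Carrier) m) n →
              coeff (RawMonoidDefs.sum (RawRing.+-rawMonoid rawTwistedRing) v) n ≈
              RawMonoidDefs.sum +-rawMonoid (λ l → coeff (v l) n)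
  coeff-sum v n = sum-homo (RawRing.+-rawMonoid rawTwistedRing) +-monoid
    (λ p → coeff p n) refl (λ p q → coeff-+ p q n) v

-- Binomial coefficients modulo a prime and the additivity of the Frobenius.

prime∣!⇒≤ : ∀ {p} → Prime p → ∀ k → p ∣ k ! → p ℕ.≤ k
prime∣!⇒≤ p-prime zero    p∣1 with ∣1⇒≡1 p∣1
... | ≡.refl = ⊥-elim (ℕ.nonTrivial⇒≢1 {{prime⇒nonTrivial p-prime}} ≡.refl)
prime∣!⇒≤ p-prime (suc k) p∣[1+k]! with euclidsLemma (suc k) (k !) p-prime p∣[1+k]!
... | inj₁ p∣1+k = ∣⇒≤ p∣1+k
... | inj₂ p∣k!  = ℕ.m≤n⇒m≤1+n (prime∣!⇒≤ p-prime k p∣k!)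

nCk*k![n∸k]!≡n! : ∀ {n k} → k ℕ.≤ n → (n C k) ℕ.* (k ! ℕ.* (n ℕ.∸ k) !) ≡ n !
nCk*k![n∸k]!≡n! {n} {k} k≤n rewrite nCk≡n!/k![n-k]! k≤n =
  m/n*n≡m {{ℕ._!*_!≢0 k (n ℕ.∸ k)}} (k![n∸k]!∣n! k≤n)

-- The prime divides its own factorial, which is the binomial coefficient times two factorials of
-- smaller numbers, and it divides neither of those. The successors encode that the lower index lies
-- strictly between 0 and the prime.
prime∣binomial : ∀ p k → Prime (suc p) → k ℕ.< p → suc p ∣ (suc p C suc k)
prime∣binomial p k p-prime k<p
  with euclidsLemma (suc p C suc k) _ p-prime
         (≡.subst (suc p ∣_) (≡.sym (nCk*k![n∸k]!≡n! (ℕ.s≤s (ℕ.<⇒≤ k<p)))) (m∣m*n (p !)))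
... | inj₁ p∣C = p∣C
... | inj₂ p∣k!m! with euclidsLemma (suc k !) ((p ℕ.∸ k) !) p-prime p∣k!m!
...   | inj₁ p∣k! = contradiction (prime∣!⇒≤ p-prime (suc k) p∣k!) (ℕ.<⇒≱ (ℕ.s≤s k<p))
...   | inj₂ p∣m! = contradiction (prime∣!⇒≤ p-prime (p ℕ.∸ k) p∣m!) (ℕ.<⇒≱ (ℕ.s≤s (ℕ.m∸n≤m p k)))

module Frobenius (R : CommutativeRing a ℓ) {p : ℕ} (p-prime : Prime p)
  (p×1≈0 : CommutativeRing._≈_ R
    (SemiringMult._×_ (CommutativeRing.semiring R) p (CommutativeRing.1# R)) (CommutativeRing.0# R)) where
  open CommutativeRing R hiding (zero)
  open SemiringMult semiring renaming (_×_ to _⋆_)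
  open CommutativeSemiringExp commutativeSemiring
  open SetoidReasoning (CommutativeRing.setoid R)
  open SemiringSum semiring using (sum; sum-init-last)

  multiple-vanishes : ∀ {n} → p ∣ n → ∀ x → n ⋆ x ≈ 0#
  multiple-vanishes (divides m ≡.refl) x = begin
    (m ℕ.* p) ⋆ x              ≈⟨ ×-congʳ (m ℕ.* p) (*-identityˡ x) ⟨
    (m ℕ.* p) ⋆ (1# * x)       ≈⟨ ×-assoc-* (m ℕ.* p) 1# x ⟨
    ((m ℕ.* p) ⋆ 1#) * x       ≈⟨ *-congʳ (×1-homo-* m p) ⟩
    ((m ⋆ 1#) * (p ⋆ 1#)) * x  ≈⟨ *-congʳ (*-congˡ p×1≈0) ⟩
    ((m ⋆ 1#) * 0#) * x        ≈⟨ *-congʳ (zeroʳ _) ⟩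
    0# * x                     ≈⟨ zeroˡ x ⟩
    0#                         ∎

  ^p-+ : ∀ x y → (x + y) ^ p ≈ x ^ p + y ^ p
  ^p-+ x y = go p ≡.refl
    where
    -- The binomial sum splits into first, middle and last terms only for a successor exponent; p is
    -- a module parameter, so it is matched through an equation.
    go : ∀ r → r ≡ p → (x + y) ^ r ≈ x ^ r + y ^ r
    go zero    ≡.refl with () ← prime⇒nonTrivial p-prime
    go (suc r) ≡.refl = begin
      (x + y) ^ suc r                                              ≈⟨ Binomial.theorem commutativeSemiring (suc r) x y ⟩
      t zero + sum (λ k → t (suc k))                               ≈⟨ +-congˡ (sum-init-last {r} (λ k → t (suc k))) ⟩
      t zero + (sum (λ k → t (suc (inject₁ k))) + t (suc (fromℕ r)))  ≈⟨ +-cong first (+-cong middle last) ⟩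
      y ^ suc r + (0# + x ^ suc r)                                 ≈⟨ +-congˡ (+-identityˡ _) ⟩
      y ^ suc r + x ^ suc r                                        ≈⟨ +-comm _ _ ⟩
      x ^ suc r + y ^ suc r                                        ∎
      where
      t : Fin (suc (suc r)) → Carrier
      t = Binomial.binomialTerm commutativeSemiring x y (suc r)

      first : t zero ≈ y ^ suc r
      first = trans (+-identityʳ _) (*-identityˡ _)

      middle : sum (λ k → t (suc (inject₁ k))) ≈ 0#
      middle = sum-zero +-commutativeMonoid _ (λ k → multiple-vanishes
        (prime∣binomial r (toℕ (inject₁ k)) p-prime
          (≡.subst (ℕ._< r) (≡.sym (toℕ-inject₁ k)) (toℕ<n k))) _)

      last : t (suc (fromℕ r)) ≈ x ^ suc r
      last rewrite toℕ-fromℕ r | nCn≡1 (suc r) | ℕ.n∸n≡0 r =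
        trans (+-identityʳ _) (*-identityʳ _)

  ^p^e-+ : ∀ e x y → (x + y) ^ (p ℕ.^ e) ≈ x ^ (p ℕ.^ e) + y ^ (p ℕ.^ e)
  ^p^e-+ zero    x y = trans (*-identityʳ _) (sym (+-cong (*-identityʳ x) (*-identityʳ y)))
  ^p^e-+ (suc e) x y = begin
    (x + y) ^ (p ℕ.* p ℕ.^ e)                        ≈⟨ ^-assocʳ (x + y) p (p ℕ.^ e) ⟨
    ((x + y) ^ p) ^ (p ℕ.^ e)                        ≈⟨ ^-congˡ (p ℕ.^ e) (^p-+ x y) ⟩
    (x ^ p + y ^ p) ^ (p ℕ.^ e)                      ≈⟨ ^p^e-+ e (x ^ p) (y ^ p) ⟩
    (x ^ p) ^ (p ℕ.^ e) + (y ^ p) ^ (p ℕ.^ e)        ≈⟨ +-cong (^-assocʳ x p _) (^-assocʳ y p _) ⟩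
    x ^ (p ℕ.* p ℕ.^ e) + y ^ (p ℕ.* p ℕ.^ e)        ∎

  1^ : ∀ n → 1# ^ n ≈ 1#
  1^ zero    = refl
  1^ (suc n) = trans (*-identityˡ _) (1^ n)

  ^p^e-homo : ∀ e → RingMorphisms.IsRingHomomorphism rawRing rawRing (_^ (p ℕ.^ e))
  ^p^e-homo e = RingEndo.mkEndo ring _ (^-congˡ (p ℕ.^ e)) (^p^e-+ e)
    (λ x y → ^-distrib-* x y (p ℕ.^ e)) (1^ (p ℕ.^ e))

-- Cancellation in fields, and the characteristic of a finite field.

module FieldProperties (K : Field a ℓ) where
  open Field K
  open SemiringMult semiring renaming (_×_ to _⋆_)
  open SetoidReasoning (Field.setoid K)

  *-cancel-0 : ∀ {x y} → ¬ x ≈ 0# → x * y ≈ 0# → y ≈ 0#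
  *-cancel-0 {x} {y} x≉0 xy≈0 = begin
    y              ≈⟨ *-identityˡ y ⟨
    1# * y         ≈⟨ *-congʳ (proj₁ (proj₂ (inverse x x≉0))) ⟨
    x⁻¹ * x * y    ≈⟨ *-assoc _ _ _ ⟩
    x⁻¹ * (x * y)  ≈⟨ *-congˡ xy≈0 ⟩
    x⁻¹ * 0#       ≈⟨ zeroʳ _ ⟩
    0#             ∎
    where x⁻¹ = proj₁ (inverse x x≉0)

  *-cancel-≉ : ∀ {x y z} → ¬ x ≈ y → x * z ≈ y * z → z ≈ 0#
  *-cancel-≉ {x} {y} {z} x≉y xz≈yz = *-cancel-0
    (x≉y ∘ RingProperties.x∙y⁻¹≈ε⇒x≈y ring x y)
    (begin
      (x - y) * z        ≈⟨ distribʳ z x (- y) ⟩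
      x * z + - y * z    ≈⟨ +-congˡ (RingProperties.-‿distribˡ-* ring y z) ⟨
      x * z - y * z      ≈⟨ RingProperties.x≈y⇒x∙y⁻¹≈ε ring xz≈yz ⟩
      0#                 ∎)

  module _ {n : ℕ} (order : Inverse (≡.setoid (Fin n)) (Field.setoid K)) where
    open Inverse order
    open CommutativeMonoidSum +-commutativeMonoid

    -- Translation by 1 permutes K, so Σ x = Σ (x + 1) = Σ x + n.
    order×1≈0 : n ⋆ 1# ≈ 0#
    order×1≈0 = AbelianGroupProperties.identityʳ-unique +-abelianGroup (sum to) (n ⋆ 1#) (begin
      sum to + n ⋆ 1#                  ≈⟨ +-congˡ (sum-replicate n) ⟨
      sum to + sum {n} (λ _ → 1#)      ≈⟨ ∑-distrib-+ to (λ _ → 1#) ⟨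
      sum (λ i → to i + 1#)            ≈⟨ sum-cong-≋ (λ i → strictlyInverseˡ (to i + 1#)) ⟨
      sum (λ i → to (from (to i + 1#))) ≈⟨ sum-permute to translation ⟨
      sum to                           ∎)
      where
      cancel : ∀ u v → u + v ≈ 0# → ∀ i → from (to (from (to i + u)) + v) ≡ i
      cancel u v u+v≈0 i = ≡.trans (from-cong (begin
        to (from (to i + u)) + v   ≈⟨ +-congʳ (strictlyInverseˡ _) ⟩
        to i + u + v               ≈⟨ +-assoc _ _ _ ⟩
        to i + (u + v)             ≈⟨ +-congˡ u+v≈0 ⟩
        to i + 0#                  ≈⟨ +-identityʳ _ ⟩
        to i                       ∎)) (strictlyInverseʳ i)

      translation = permutation (λ i → from (to i + 1#)) (λ i → from (to i - 1#))
        (cancel (- 1#) 1# (-‿inverseˡ 1#)) (cancel 1# (- 1#) (-‿inverseʳ 1#))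

  module _ {p e : ℕ} (order : Inverse (≡.setoid (Fin (p ℕ.^ e))) (Field.setoid K)) where
    open Inverse order

    -- Equality in K is decidable through its enumeration by `Fin`, so the argument may go by
    -- contradiction: a non-zero p · 1 could be cancelled e times from p^e · 1 = 0, leaving 1 = 0.
    characteristic : p ⋆ 1# ≈ 0#
    characteristic with from (p ⋆ 1#) ≟ from 0#
    ... | yes eq = trans (sym (strictlyInverseˡ _)) (trans (to-cong eq) (strictlyInverseˡ _))
    ... | no neq = ⊥-elim (descend e (order×1≈0 order))
      where
      descend : ∀ e → ¬ (p ℕ.^ e) ⋆ 1# ≈ 0#
      descend zero    1≈0 = 1≉0 (trans (sym (+-identityʳ 1#)) 1≈0)
      descend (suc e) q≈0 = descend e (*-cancel-0 (neq ∘ from-cong)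
        (trans (sym (×1-homo-* p (p ℕ.^ e))) q≈0))

    -- The setting does not ask for e > 0; the axiom 1 ≠ 0 of the field rules out e = 0.
    order≢1 : p ℕ.^ e ≢ 1
    order≢1 q≡1 = 1≉0 (begin
      1#                 ≈⟨ +-identityʳ 1# ⟨
      1 ⋆ 1#             ≡⟨ ≡.cong (_⋆ 1#) q≡1 ⟨
      (p ℕ.^ e) ⋆ 1#     ≈⟨ order×1≈0 order ⟩
      0#                 ∎)

-- Powers and integer multiples under ring homomorphisms.

module _ (R : Ring a ℓ) (R′ : Ring b ℓ′) where
  private
    module R  = Ring R
    module R′ = Ring R′
  open SemiringExp
  open RingMorphisms R.rawRing R′.rawRing

  homo-^ : ∀ {f} → IsRingHomomorphism f → ∀ x n →
           f (_^_ R.semiring x n) R′.≈ _^_ R′.semiring (f x) n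
  homo-^ f-hom x zero    = IsRingHomomorphism.1#-homo f-hom
  homo-^ f-hom x (suc n) = R′.trans (IsRingHomomorphism.*-homo f-hom _ _)
    (R′.*-congˡ (homo-^ f-hom x n))

  homo-× : ∀ {f} → IsRingHomomorphism f → ∀ n →
           f (SemiringMult._×_ R.semiring n R.1#) R′.≈ SemiringMult._×_ R′.semiring n R′.1#
  homo-× f-hom zero    = IsRingHomomorphism.0#-homo f-hom
  homo-× f-hom (suc n) = R′.trans (IsRingHomomorphism.+-homo f-hom _ _)
    (R′.+-cong (IsRingHomomorphism.1#-homo f-hom) (homo-× f-hom n))

-- Intertwiners between elements of the form scalar plus nilpotent.

module Commuting (R : Ring a ℓ) where
  open Ring R hiding (zero)
  open SemiringExp semiring
  open SetoidReasoning setoid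

  ^-comm : ∀ {x y} → x * y ≈ y * x → ∀ n → x * y ^ n ≈ y ^ n * x
  ^-comm {x} {y} xy≈yx zero    = trans (*-identityʳ x) (sym (*-identityˡ x))
  ^-comm {x} {y} xy≈yx (suc n) = begin
    x * (y * y ^ n)  ≈⟨ *-assoc x y _ ⟨
    x * y * y ^ n    ≈⟨ *-congʳ xy≈yx ⟩
    y * x * y ^ n    ≈⟨ *-assoc y x _ ⟩
    y * (x * y ^ n)  ≈⟨ *-congˡ (^-comm xy≈yx n) ⟩
    y * (y ^ n * x)  ≈⟨ *-assoc y _ x ⟨
    y * y ^ n * x    ∎

  y≈0⇒x*y≈0 : ∀ x {y} → y ≈ 0# → x * y ≈ 0#
  y≈0⇒x*y≈0 x y≈0 = trans (*-congˡ y≈0) (zeroʳ x)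

  -- In the application t and s are the scalar matrices θ and θ^(qⁿ), while u = a₀ and v = σⁿ(a₀).
  -- The assumption `separated` replaces the statement that uⁱ and vⁱ have no common eigenvalue.
  module _ {t s N N′ u v : Carrier}
    (t-central : ∀ x → t * x ≈ x * t) (s-central : ∀ x → s * x ≈ x * s)
    (u≈t+N : u ≈ t + N) (v≈s+N′ : v ≈ s + N′)
    (i : ℕ) (separated : ∀ x → t ^ i * x ≈ s ^ i * x → x ≈ 0#) where

    private
      Nu≈uN : N * u ≈ u * N
      Nu≈uN = begin
        N * u          ≈⟨ *-congˡ u≈t+N ⟩
        N * (t + N)    ≈⟨ distribˡ N t N ⟩
        N * t + N * N  ≈⟨ +-congʳ (t-central N) ⟨
        t * N + N * N  ≈⟨ distribʳ N t N ⟨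
        (t + N) * N    ≈⟨ *-congʳ u≈t+N ⟨
        u * N          ∎

      N′v≈vN′ : N′ * v ≈ v * N′
      N′v≈vN′ = begin
        N′ * v            ≈⟨ *-congˡ v≈s+N′ ⟩
        N′ * (s + N′)     ≈⟨ distribˡ N′ s N′ ⟩
        N′ * s + N′ * N′  ≈⟨ +-congʳ (s-central N′) ⟨
        s * N′ + N′ * N′  ≈⟨ distribʳ N′ s N′ ⟨
        (s + N′) * N′     ≈⟨ *-congʳ v≈s+N′ ⟨
        v * N′            ∎

      -- Centrality of t keeps every t ^ n * x in the kernel of N, so each further factor u = t + N
      -- acts as t.
      eigenˡ : ∀ {x} → N * x ≈ 0# → ∀ n → u ^ n * x ≈ t ^ n * x
      eigenˡ {x} Nx≈0 zero    = refl
      eigenˡ {x} Nx≈0 (suc n) = begin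
        u * u ^ n * x              ≈⟨ *-assoc u _ x ⟩
        u * (u ^ n * x)            ≈⟨ *-cong u≈t+N (eigenˡ Nx≈0 n) ⟩
        (t + N) * (t ^ n * x)      ≈⟨ distribʳ _ t N ⟩
        t * (t ^ n * x) + N * (t ^ n * x)  ≈⟨ +-cong (sym (*-assoc t _ x)) (begin
          N * (t ^ n * x)    ≈⟨ *-assoc N _ x ⟨
          N * t ^ n * x      ≈⟨ *-congʳ (^-comm (sym (t-central N)) n) ⟩
          t ^ n * N * x      ≈⟨ *-assoc _ N x ⟩
          t ^ n * (N * x)    ≈⟨ y≈0⇒x*y≈0 _ Nx≈0 ⟩
          0#                 ∎) ⟩
        t ^ suc n * x + 0#         ≈⟨ +-identityʳ _ ⟩
        t ^ suc n * x              ∎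

      eigenʳ : ∀ {x} → x * N′ ≈ 0# → ∀ n → x * v ^ n ≈ s ^ n * x
      eigenʳ {x} xN′≈0 zero    = trans (*-identityʳ x) (sym (*-identityˡ x))
      eigenʳ {x} xN′≈0 (suc n) = begin
        x * (v * v ^ n)     ≈⟨ *-assoc x v _ ⟨
        x * v * v ^ n       ≈⟨ *-congʳ (begin
          x * v               ≈⟨ *-congˡ v≈s+N′ ⟩
          x * (s + N′)        ≈⟨ distribˡ x s N′ ⟩
          x * s + x * N′      ≈⟨ +-cong (sym (s-central x)) xN′≈0 ⟩
          s * x + 0#          ≈⟨ +-identityʳ _ ⟩
          s * x               ∎) ⟩
        s * x * v ^ n       ≈⟨ *-assoc s x _ ⟩
        s * (x * v ^ n)     ≈⟨ *-congˡ (eigenʳ xN′≈0 n) ⟩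
        s * (s ^ n * x)     ≈⟨ *-assoc s _ x ⟨
        s ^ suc n * x       ∎

    -- The solutions x are stable under x ↦ N x and x ↦ x N′, which lowers one
    -- of the exponents; once both kill x, u and v act as the scalars t and s.
    intertwiner-vanishes : ∀ c d x → u ^ i * x ≈ x * v ^ i →
                           N ^ c * x ≈ 0# → x * N′ ^ d ≈ 0# → x ≈ 0#
    intertwiner-vanishes zero    d       x ux≈xv x₁ x₂ = trans (sym (*-identityˡ x)) x₁
    intertwiner-vanishes (suc c) zero    x ux≈xv x₁ x₂ = trans (sym (*-identityʳ x)) x₂
    intertwiner-vanishes (suc c) (suc d) x ux≈xv x₁ x₂ = separated x (begin
      t ^ i * x  ≈⟨ eigenˡ Nx≈0 i ⟨
      u ^ i * x  ≈⟨ ux≈xv ⟩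
      x * v ^ i  ≈⟨ eigenʳ xN′≈0 i ⟩
      s ^ i * x  ∎)
      where
      Nx≈0 : N * x ≈ 0#
      Nx≈0 = intertwiner-vanishes c (suc d) (N * x)
        (begin
          u ^ i * (N * x)   ≈⟨ *-assoc _ N x ⟨
          u ^ i * N * x     ≈⟨ *-congʳ (^-comm Nu≈uN i) ⟨
          N * u ^ i * x     ≈⟨ *-assoc N _ x ⟩
          N * (u ^ i * x)   ≈⟨ *-congˡ ux≈xv ⟩
          N * (x * v ^ i)   ≈⟨ *-assoc N x _ ⟨
          N * x * v ^ i     ∎)
        (begin
          N ^ c * (N * x)   ≈⟨ *-assoc _ N x ⟨
          N ^ c * N * x     ≈⟨ *-congʳ (^-comm refl c) ⟨
          N ^ suc c * x     ≈⟨ x₁ ⟩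
          0#                ∎)
        (trans (*-assoc N x _) (y≈0⇒x*y≈0 N x₂))

      xN′≈0 : x * N′ ≈ 0#
      xN′≈0 = intertwiner-vanishes (suc c) d (x * N′)
        (begin
          u ^ i * (x * N′)  ≈⟨ *-assoc _ x N′ ⟨
          u ^ i * x * N′    ≈⟨ *-congʳ ux≈xv ⟩
          x * v ^ i * N′    ≈⟨ *-assoc x _ N′ ⟩
          x * (v ^ i * N′)  ≈⟨ *-congˡ (^-comm N′v≈vN′ i) ⟨
          x * (N′ * v ^ i)  ≈⟨ *-assoc x N′ _ ⟨
          x * N′ * v ^ i    ∎)
        (trans (sym (*-assoc _ x N′)) (trans (*-congʳ x₁) (zeroˡ N′)))
        (trans (*-assoc x N′ _) x₂)

-- Consequences of the setting: characteristic of 𝓕, powers of θ, matrices over 𝓕.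

module SettingProperties {c ℓ : Level} (S : Setting c ℓ) where
  open Setting S public hiding (k)
  open SemiringExp 𝓕.semiring

  id-homo : RingMorphisms.IsRingHomomorphism 𝔽q.rawRing 𝔽q.rawRing id
  id-homo = RingEndo.mkEndo 𝔽q.ring id id (λ _ _ → 𝔽q.refl) (λ _ _ → 𝔽q.refl) 𝔽q.refl

  module AR = TwistedRing 𝔽q.ring id-homo

  A-ring : Ring _ _
  A-ring = AR.twistedRing

  A→𝓕-mono : RingMorphisms.IsRingMonomorphism A.ring 𝓕.rawRing A→𝓕
  A→𝓕-mono = isRingMonomorphism 𝓕.trans
    (IsRationalFunctionField.isRingMonomorphism k-frac) (FieldEmbedding.isRingMonomorphism k⊂𝓕)

  module A→𝓕 = RingMorphisms.IsRingMonomorphism A→𝓕-mono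

  open SemiringMult 𝔽q.semiring using () renaming (_×_ to _𝔽⋆_)
  open SemiringMult 𝓕.semiring using () renaming (_×_ to _𝓕⋆_)
  open SemiringMult (Ring.semiring A-ring) using () renaming (_×_ to _A⋆_)

  multiple-of-1 : ∀ n → (n A⋆ Ring.1# A-ring) AR.≋ (n 𝔽⋆ 𝔽q.1# ∷ [])
  multiple-of-1 zero    zero    = 𝔽q.refl
  multiple-of-1 zero    (suc k) = 𝔽q.refl
  multiple-of-1 (suc n) k       = 𝔽q.trans (AR.coeff-+ (𝔽q.1# ∷ []) (n A⋆ Ring.1# A-ring) k)
    (𝔽q.trans (𝔽q.+-congˡ (multiple-of-1 n k))
    (𝔽q.sym (AR.coeff-+ (𝔽q.1# ∷ []) (n 𝔽⋆ 𝔽q.1# ∷ []) k)))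

  -- 𝔽q reaches 𝓕 only by way of A = 𝔽q[T], so p = 0 is first established for the constant
  -- polynomials and then transported.
  characteristic-𝓕 : p 𝓕⋆ 𝓕.1# 𝓕.≈ 𝓕.0#
  characteristic-𝓕 = begin
    p 𝓕⋆ 𝓕.1#                ≈⟨ homo-× A-ring 𝓕.ring A→𝓕.isRingHomomorphism p ⟨
    A→𝓕 (p A⋆ Ring.1# A-ring) ≈⟨ A→𝓕.⟦⟧-cong vanish ⟩
    A→𝓕 []                   ≈⟨ A→𝓕.0#-homo ⟩
    𝓕.0#                     ∎
    where
    open SetoidReasoning 𝓕.setoid
    vanish : (p A⋆ Ring.1# A-ring) AR.≋ []
    vanish zero    = 𝔽q.trans (multiple-of-1 p 0) (FieldProperties.characteristic 𝔽q {p} {e} order)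
    vanish (suc k) = multiple-of-1 p (suc k)

  frob-homo : RingMorphisms.IsRingHomomorphism 𝓕.rawRing 𝓕.rawRing frob
  frob-homo = Frobenius.^p^e-homo 𝓕.commutativeRing p-prime characteristic-𝓕 e

  1<q : 1 ℕ.< q
  1<q = ℕ.≤∧≢⇒< (ℕ.m^n>0 p {{prime⇒nonZero p-prime}} e)
    (FieldProperties.order≢1 𝔽q {p} {e} order ∘ ≡.sym)

  T^-mono : ∀ n → (T^ n) AR.≋ AR.mono 𝔽q.1# n
  T^-mono zero    k = 𝔽q.refl
  T^-mono (suc n) k = begin
    A.coeff (A.X A.*ₚ T^ n) k                       ≈⟨ AR.shift-*ₚ (𝔽q.1# ∷ []) (T^ n) k ⟩
    A.coeff (𝔽q.0# ∷ (𝔽q.1# ∷ []) A.*ₚ map id (T^ n)) k  ≈⟨ AR.shift-cong _ _ (AR.*ₚ-identityˡ (map id (T^ n))) k ⟩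
    A.coeff (𝔽q.0# ∷ map id (T^ n)) k               ≡⟨ ≡.cong (λ P → A.coeff (𝔽q.0# ∷ P) k) (map-id (T^ n)) ⟩
    A.coeff (𝔽q.0# ∷ T^ n) k                        ≈⟨ AR.shift-cong (T^ n) (AR.mono 𝔽q.1# n) (T^-mono n) k ⟩
    A.coeff (AR.mono 𝔽q.1# (suc n)) k               ∎
    where open SetoidReasoning 𝔽q.setoid

  T^-injective : ∀ {m n} → m ≢ n → ¬ (T^ m) AR.≋ (T^ n)
  T^-injective {m} {n} m≢n Tᵐ≈Tⁿ = 𝔽q.1≉0 (begin
    𝔽q.1#                       ≈⟨ AR.coeff-mono-≡ 𝔽q.1# m ⟨
    A.coeff (AR.mono 𝔽q.1# m) m ≈⟨ T^-mono m m ⟨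
    A.coeff (T^ m) m            ≈⟨ Tᵐ≈Tⁿ m ⟩
    A.coeff (T^ n) m            ≈⟨ T^-mono n m ⟩
    A.coeff (AR.mono 𝔽q.1# n) m ≈⟨ AR.coeff-mono-≢ 𝔽q.1# n m (m≢n ∘ ≡.sym) ⟩
    𝔽q.0#                       ∎)
    where open SetoidReasoning 𝔽q.setoid

  -- Transcendence of T in the form needed: θ is the image of T under the injective map from 𝔽q[T],
  -- where distinct powers of T differ in a coefficient.
  θ^-injective : ∀ {m n} → m ≢ n → ¬ θ ^ m 𝓕.≈ θ ^ n
  θ^-injective {m} {n} m≢n eq = T^-injective m≢n (A→𝓕.injective
    (𝓕.trans (θ^ m) (𝓕.trans eq (𝓕.sym (θ^ n)))))
    where
    θ^ : ∀ n → A→𝓕 (T^ n) 𝓕.≈ θ ^ n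
    θ^ = homo-^ A-ring 𝓕.ring A→𝓕.isRingHomomorphism A.X

  iterate-frob : ∀ x n → iterate frob x n 𝓕.≈ x ^ (q ℕ.^ n)
  iterate-frob x zero    = 𝓕.sym (𝓕.*-identityʳ x)
  iterate-frob x (suc n) = 𝓕.trans (iterate-frob (frob x) n) (^-assocʳ x q (q ℕ.^ n))

  -- The right-hand power is θ^(qⁿ i), and qⁿ i > i because q > 1, n > 0 and i > 0. The positivity
  -- of the degree of Φ(T) and of the exponent of T are both spent here.
  θ-separated : ∀ {n i} → 0 ℕ.< n → 0 ℕ.< i → ¬ θ ^ i 𝓕.≈ iterate frob θ n ^ i
  θ-separated {n} {i} 0<n 0<i eq = θ^-injective (ℕ.<⇒≢ i<qⁿ*i) (begin
    θ ^ i                      ≈⟨ eq ⟩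
    iterate frob θ n ^ i       ≈⟨ ^-congˡ i (iterate-frob θ n) ⟩
    (θ ^ (q ℕ.^ n)) ^ i        ≈⟨ ^-assocʳ θ (q ℕ.^ n) i ⟩
    θ ^ (q ℕ.^ n ℕ.* i)        ∎)
    where
    open SetoidReasoning 𝓕.setoid
    i<qⁿ*i : i ℕ.< q ℕ.^ n ℕ.* i
    i<qⁿ*i = ≡.subst (ℕ._< q ℕ.^ n ℕ.* i) (ℕ.*-identityˡ i)
      (ℕ.*-monoˡ-< i {{ℕ.>-nonZero 0<i}} (ℕ.^-monoʳ-< q 1<q 0<n))

  module Matrices (m : ℕ) where
    open MatrixRing 𝓕.ring m public
    open M m public using (Mat; scalar)
    module Mat = Ring matrixRing

    frobᴹ : Mat → Mat
    frobᴹ B i j = frob (B i j)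

    private
      module frob = RingMorphisms.IsRingHomomorphism frob-homo

    iterate-frobᴹ : ∀ B n i j → iterate frobᴹ B n i j ≡ iterate frob (B i j) n
    iterate-frobᴹ B zero    i j = ≡.refl
    iterate-frobᴹ B (suc n) i j = iterate-frobᴹ (frobᴹ B) n i j

    scalar-homo : ∀ {f : 𝓕.Carrier → 𝓕.Carrier} → f 𝓕.0# 𝓕.≈ 𝓕.0# →
                  ∀ x i j → f (scalar x i j) 𝓕.≈ scalar (f x) i j
    scalar-homo f0 x i j with does (i ≟ j)
    ... | true  = 𝓕.refl
    ... | false = f0

    frobᴹ-homo : RingMorphisms.IsRingHomomorphism Mat.rawRing Mat.rawRing frobᴹ
    frobᴹ-homo = RingEndo.mkEndo matrixRing frobᴹ (λ eq i j → frob.⟦⟧-cong (eq i j))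
      (λ _ _ _ _ → frob.+-homo _ _)
      (λ B C i j → 𝓕.trans
        (sum-homo 𝓕.+-rawMonoid 𝓕.+-monoid frob frob.0#-homo frob.+-homo (λ l → B i l 𝓕.* C l j))
        (SemiringSum.sum-cong-≋ 𝓕.semiring (λ l → frob.*-homo (B i l) (C l j))))
      (λ i j → 𝓕.trans (scalar-homo {frob} frob.0#-homo 𝓕.1# i j) (scalar-cong frob.1#-homo i j))
      where
      scalar-cong : ∀ {x y} → x 𝓕.≈ y → ∀ i j → scalar x i j 𝓕.≈ scalar y i j
      scalar-cong x≈y i j with does (i ≟ j)
      ... | true  = x≈y
      ... | false = 𝓕.refl

    module MτR = TwistedRing matrixRing frobᴹ-homo

    scalar-central : ∀ x B → scalar x Mat.* B Mat.≈ B Mat.* scalar x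
    scalar-central x B i j = 𝓕.trans (scalar-column (λ l → B l j) x i)
      (𝓕.trans (𝓕.*-comm _ _) (𝓕.sym (row-scalar (B i) x j)))

    -- Stated entrywise, so that the separation of the two scalar matrices becomes a cancellation in
    -- the field 𝓕.
    scalar-^-* : ∀ x n B i j →
      (SemiringExp._^_ Mat.semiring (scalar x) n Mat.* B) i j 𝓕.≈ x ^ n 𝓕.* B i j
    scalar-^-* x zero    B i j = scalar-column (λ l → B l j) 𝓕.1# i
    scalar-^-* x (suc n) B i j = begin
      (scalar x Mat.* xⁿ Mat.* B) i j      ≈⟨ Mat.*-assoc (scalar x) xⁿ B i j ⟩
      (scalar x Mat.* (xⁿ Mat.* B)) i j    ≈⟨ scalar-column (λ l → (xⁿ Mat.* B) l j) x i ⟩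
      x 𝓕.* (xⁿ Mat.* B) i j               ≈⟨ 𝓕.*-congˡ (scalar-^-* x n B i j) ⟩
      x 𝓕.* (x ^ n 𝓕.* B i j)              ≈⟨ 𝓕.*-assoc x _ _ ⟨
      x ^ suc n 𝓕.* B i j                  ∎
      where
      open SetoidReasoning 𝓕.setoid
      xⁿ = SemiringExp._^_ Mat.semiring (scalar x) n

  -- The constant and leading coefficients of Φ(Tⁱ).

  module TModuleProperties {m : ℕ} (𝒜 : TModule S m) where
    open TModule 𝒜 public
    open Matrices m public
    private
      module Φ = RingMorphisms.IsRingHomomorphism Φ-ringHom
      module Mτm = Mτ m
      module Iter n = RingMorphisms.IsRingHomomorphism (RingEndo.iterate-homo matrixRing frobᴹ-homo n)
    open SemiringExp Mat.semiring using () renaming (_^_ to _^ᴹ_; ^-congˡ to ^ᴹ-congˡ)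

    Φ-T^0 : Φ (T^ 0) MτR.≋ (Mat.1# ∷ [])
    Φ-T^0 = Φ.1#-homo

    Φ-T^ : ∀ i → Φ (T^ suc i) MτR.≋ (Φ A.X Mτm.*ₚ Φ (T^ i))
    Φ-T^ i = Φ.*-homo A.X (T^ i)

    a₀ : Mat
    a₀ = Mτm.coeff (Φ A.X) 0

    Φ-T^-constant : ∀ i → Mτm.coeff (Φ (T^ i)) 0 Mat.≈ a₀ ^ᴹ i
    Φ-T^-constant zero    = Φ.1#-homo 0
    Φ-T^-constant (suc i) = Mat.trans (Φ-T^ i 0)
      (Mat.trans (MτR.coeff-*-0 (Φ A.X) (Φ (T^ i))) (Mat.*-congˡ (Φ-T^-constant i)))

    Φ-T^-nonconstant : 0 ℕ.< degree → ∀ {i} → 0 ℕ.< i →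
      ¬ (∀ n → Mτm.coeff (Φ (T^ i)) (suc n) Mat.≈ Mat.0#)
    Φ-T^-nonconstant 0<d {i} 0<i constant =
      Mτm.HasLeadingCoeff.nonzero Φ-leading
        (Mat.trans (Mat.sym (Mτm.HasLeadingCoeff.coeff≈ Φ-leading)) aₙ≈0)
      where
      open SetoidReasoning Mat.setoid
      n  = degree
      F  = Φ (T^ i)
      aₙ = Mτm.coeff (Φ A.X) n
      ν  = proj₁ N-nilpotent
      σⁿ = λ B → iterate frobᴹ B n

      commute : (Φ A.X Mτm.*ₚ F) MτR.≋ (F Mτm.*ₚ Φ A.X)
      commute j = Mat.trans (Mat.sym (Φ.*-homo A.X (T^ i) j)) (Mat.trans
        (Φ.⟦⟧-cong (Commuting.^-comm A-ring {A.X} {A.X} (λ _ → 𝔽q.refl) i) j)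
        (Φ.*-homo (T^ i) A.X j))

      -- Compare the coefficients of τⁿ in F Φ(T) = Φ(T) F for the supposedly constant F, whose
      -- value is a₀ⁱ.
      intertwines : (a₀ ^ᴹ i) Mat.* aₙ Mat.≈ aₙ Mat.* (σⁿ a₀ ^ᴹ i)
      intertwines = begin
        (a₀ ^ᴹ i) Mat.* aₙ               ≈⟨ Mat.*-congʳ {aₙ} (Φ-T^-constant i) ⟨
        Mτm.coeff F 0 Mat.* aₙ           ≈⟨ MτR.coeff-constant-* F (Φ A.X) constant n ⟨
        Mτm.coeff (F Mτm.*ₚ Φ A.X) n     ≈⟨ commute n ⟨
        Mτm.coeff (Φ A.X Mτm.*ₚ F) n     ≈⟨ MτR.coeff-*-constant (Φ A.X) F constant n ⟩
        aₙ Mat.* σⁿ (Mτm.coeff F 0)      ≈⟨ Mat.*-congˡ {aₙ} (Iter.⟦⟧-cong n (Φ-T^-constant i)) ⟩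
        aₙ Mat.* σⁿ (a₀ ^ᴹ i)            ≈⟨ Mat.*-congˡ {aₙ} (homo-^ matrixRing matrixRing
                                              (RingEndo.iterate-homo matrixRing frobᴹ-homo n) a₀ i) ⟩
        aₙ Mat.* (σⁿ a₀ ^ᴹ i)            ∎

      σⁿa₀ : σⁿ a₀ Mat.≈ scalar (iterate frob θ n) Mat.+ σⁿ N
      σⁿa₀ = begin
        σⁿ a₀                     ≈⟨ Iter.⟦⟧-cong n Φ-constant ⟩
        σⁿ (scalar θ Mat.+ N)     ≈⟨ Iter.+-homo n (scalar θ) N ⟩
        σⁿ (scalar θ) Mat.+ σⁿ N  ≈⟨ Mat.+-congʳ {σⁿ N} (λ r s → 𝓕.trans
          (𝓕.reflexive (iterate-frobᴹ (scalar θ) n r s))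
          (scalar-homo {λ x → iterate frob x n}
            (RingMorphisms.IsRingHomomorphism.0#-homo (RingEndo.iterate-homo 𝓕.ring frob-homo n)) θ r s)) ⟩
        scalar (iterate frob θ n) Mat.+ σⁿ N  ∎

      σⁿN^ν : σⁿ N ^ᴹ ν Mat.≈ Mat.0#
      σⁿN^ν = begin
        σⁿ N ^ᴹ ν    ≈⟨ homo-^ matrixRing matrixRing (RingEndo.iterate-homo matrixRing frobᴹ-homo n) N ν ⟨
        σⁿ (N ^ᴹ ν)  ≈⟨ Iter.⟦⟧-cong n (proj₂ N-nilpotent) ⟩
        σⁿ Mat.0#    ≈⟨ Iter.0#-homo n ⟩
        Mat.0#       ∎

      separated : ∀ X → (scalar θ ^ᴹ i) Mat.* X Mat.≈ (scalar (iterate frob θ n) ^ᴹ i) Mat.* X →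
                  X Mat.≈ Mat.0#
      separated X eq r s = FieldProperties.*-cancel-≉ 𝓕 (θ-separated {n} {i} 0<d 0<i)
        (𝓕.trans (𝓕.sym (scalar-^-* θ i X r s)) (𝓕.trans (eq r s)
          (scalar-^-* (iterate frob θ n) i X r s)))

      aₙ≈0 : aₙ Mat.≈ Mat.0#
      -- The same exponent ν serves on both sides, since σⁿ is a ring endomorphism and carries N^ν =
      -- 0 to σⁿ(N)^ν = 0.
      aₙ≈0 = Commuting.intertwiner-vanishes matrixRing
        {scalar θ} {scalar (iterate frob θ n)} {N} {σⁿ N} {a₀} {σⁿ a₀}
        (scalar-central θ) (scalar-central _) Φ-constant σⁿa₀ i separated ν ν aₙ intertwines
        (begin
          (N ^ᴹ ν) Mat.* aₙ     ≈⟨ Mat.*-congʳ {aₙ} (proj₂ N-nilpotent) ⟩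
          Mat.0# Mat.* aₙ       ≈⟨ Mat.zeroˡ aₙ ⟩
          Mat.0#                ∎)
        (begin
          aₙ Mat.* (σⁿ N ^ᴹ ν)  ≈⟨ Mat.*-congˡ {aₙ} σⁿN^ν ⟩
          aₙ Mat.* Mat.0#       ≈⟨ Mat.zeroʳ aₙ ⟩
          Mat.0#                ∎)

-- The 𝓕[T]-module 𝓕{τ}^m of row vectors.

module HomModule {c ℓ : Level} (S : Setting c ℓ) {m : ℕ} (𝒜 : TModule S m) where
  open SettingProperties S
  open TModuleProperties 𝒜

  module FτR = TwistedRing 𝓕.ring frob-homo
  open FτR using (_≋_; mono)
  module Fτ = Ring FτR.twistedRing
  module FτMat = MatrixRing FτR.twistedRing m
  open 𝓕τ using (coeff; scale)
  module Mτm = Mτ m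

  -- Its equality and addition unfold to those of `Hom-𝔾ₐ`, so expansions found in W answer the
  -- definition of finite generation directly.
  W : CommutativeMonoid _ _
  W = Pointwise.commutativeMonoid (Fin m) Fτ.+-commutativeMonoid

  module W = CommutativeMonoid W
  module FτM = Matrix Fτ.rawRing m
  module ΣW = CommutativeMonoidSum W
  module ΣFτ = SemiringSum Fτ.semiring
  module Σ𝓕 = SemiringSum 𝓕.semiring

  infixl 7 _∘ᴹ_
  _∘ᴹ_ : W.Carrier → List Mat → W.Carrier
  _∘ᴹ_ = compose S 𝒜

  infixr 7 _·_
  _·_ : List 𝓕.Carrier → W.Carrier → W.Carrier
  _·_ = act S 𝒜

  scaleᴹ : 𝓕.Carrier → W.Carrier → W.Carrier
  scaleᴹ x f j = scale x (f j)

  scale-cong : ∀ x p q → p ≋ q → scale x p ≋ scale x q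
  scale-cong x p q p≋q n = 𝓕.trans (FτR.coeff-scale x p n)
    (𝓕.trans (𝓕.*-congˡ (p≋q n)) (𝓕.sym (FτR.coeff-scale x q n)))

  scale-+ : ∀ x p q → scale x (p 𝓕τ.+ₚ q) ≋ (scale x p 𝓕τ.+ₚ scale x q)
  scale-+ x p q n = begin
    coeff (scale x (p 𝓕τ.+ₚ q)) n                 ≈⟨ FτR.coeff-scale x (p 𝓕τ.+ₚ q) n ⟩
    x 𝓕.* coeff (p 𝓕τ.+ₚ q) n                     ≈⟨ 𝓕.*-congˡ (FτR.coeff-+ p q n) ⟩
    x 𝓕.* (coeff p n 𝓕.+ coeff q n)               ≈⟨ 𝓕.distribˡ x _ _ ⟩
    x 𝓕.* coeff p n 𝓕.+ x 𝓕.* coeff q n           ≈⟨ 𝓕.+-cong (FτR.coeff-scale x p n) (FτR.coeff-scale x q n) ⟨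
    coeff (scale x p) n 𝓕.+ coeff (scale x q) n   ≈⟨ FτR.coeff-+ (scale x p) (scale x q) n ⟨
    coeff (scale x p 𝓕τ.+ₚ scale x q) n           ∎
    where open SetoidReasoning 𝓕.setoid

  +-scale : ∀ x y p → scale (x 𝓕.+ y) p ≋ (scale x p 𝓕τ.+ₚ scale y p)
  +-scale x y p n = begin
    coeff (scale (x 𝓕.+ y) p) n                   ≈⟨ FτR.coeff-scale (x 𝓕.+ y) p n ⟩
    (x 𝓕.+ y) 𝓕.* coeff p n                       ≈⟨ 𝓕.distribʳ _ x y ⟩
    x 𝓕.* coeff p n 𝓕.+ y 𝓕.* coeff p n           ≈⟨ 𝓕.+-cong (FτR.coeff-scale x p n) (FτR.coeff-scale y p n) ⟨
    coeff (scale x p) n 𝓕.+ coeff (scale y p) n   ≈⟨ FτR.coeff-+ (scale x p) (scale y p) n ⟨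
    coeff (scale x p 𝓕τ.+ₚ scale y p) n           ∎
    where open SetoidReasoning 𝓕.setoid

  *-scale : ∀ x y p → scale (x 𝓕.* y) p ≋ scale x (scale y p)
  *-scale x y p n = begin
    coeff (scale (x 𝓕.* y) p) n     ≈⟨ FτR.coeff-scale (x 𝓕.* y) p n ⟩
    x 𝓕.* y 𝓕.* coeff p n           ≈⟨ 𝓕.*-assoc x y _ ⟩
    x 𝓕.* (y 𝓕.* coeff p n)         ≈⟨ 𝓕.*-congˡ (FτR.coeff-scale y p n) ⟨
    x 𝓕.* coeff (scale y p) n       ≈⟨ FτR.coeff-scale x (scale y p) n ⟨
    coeff (scale x (scale y p)) n   ∎
    where open SetoidReasoning 𝓕.setoid

  1-scale : ∀ p → scale 𝓕.1# p ≋ p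
  1-scale p n = 𝓕.trans (FτR.coeff-scale 𝓕.1# p n) (𝓕.*-identityˡ _)

  0-scale : ∀ p → scale 𝓕.0# p ≋ []
  0-scale p n = 𝓕.trans (FτR.coeff-scale 𝓕.0# p n) (𝓕.zeroˡ _)

  sum-at : ∀ {r} (v : Vector W.Carrier r) j → ΣW.sum v j ≋ ΣFτ.sum (λ i → v i j)
  sum-at v j = sum-homo W.rawMonoid Fτ.+-monoid (λ w → w j) (λ _ → 𝓕.refl) (λ _ _ _ → 𝓕.refl) v

  entry : Fin m → Fin m → List Mat → List 𝓕.Carrier
  entry i j = map (λ B → B i j)

  coeff-entry : ∀ i j P n → coeff (entry i j P) n 𝓕.≈ Mτm.coeff P n i j
  coeff-entry i j []      n       = 𝓕.refl
  coeff-entry i j (B ∷ P) zero    = 𝓕.refl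
  coeff-entry i j (B ∷ P) (suc n) = coeff-entry i j P n

  entry-frob : ∀ i j P → entry i j (map frobᴹ P) ≡ map frob (entry i j P)
  entry-frob i j P = ≡.trans (≡.sym (map-∘ P)) (map-∘ P)

  -- The multiplicative half of the identification of 𝓕^{m,m}{τ} with matrices over 𝓕{τ}. It rests
  -- on the Frobenius of a matrix being entrywise, and it reduces composition of row vectors to
  -- matrix algebra over 𝓕{τ}.
  coeff-entry-* : ∀ P Q n i j → Mτm.coeff (P Mτm.*ₚ Q) n i j 𝓕.≈
    Σ𝓕.sum (λ l → coeff (entry i l P 𝓕τ.*ₚ entry l j Q) n)
  coeff-entry-* []      Q n i j = 𝓕.sym (sum-zero 𝓕.+-commutativeMonoid {m} _ (λ _ → 𝓕.refl))
  coeff-entry-* (B ∷ P) Q n i j = begin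
    Mτm.coeff ((B ∷ P) Mτm.*ₚ Q) n i j
      ≈⟨ MτR.coeff-∷-* B P Q n i j ⟩
    Σ𝓕.sum (λ l → B i l 𝓕.* Mτm.coeff Q n l j) 𝓕.+ Mτm.coeff (Mat.0# ∷ (P Mτm.*ₚ map frobᴹ Q)) n i j
      ≈⟨ 𝓕.+-cong (Σ𝓕.sum-cong-≋ (λ l → 𝓕.*-congˡ {B i l} (𝓕.sym (coeff-entry l j Q n)))) (shift n) ⟩
    Σ𝓕.sum (λ l → B i l 𝓕.* coeff (entry l j Q) n) 𝓕.+ Σ𝓕.sum (λ l → tail l n)
      ≈⟨ Σ𝓕.∑-distrib-+ (λ l → B i l 𝓕.* coeff (entry l j Q) n) (λ l → tail l n) ⟨
    Σ𝓕.sum (λ l → B i l 𝓕.* coeff (entry l j Q) n 𝓕.+ tail l n)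
      ≈⟨ Σ𝓕.sum-cong-≋ (λ l → FτR.coeff-∷-* (B i l) (entry i l P) (entry l j Q) n) ⟨
    Σ𝓕.sum (λ l → coeff (entry i l (B ∷ P) 𝓕τ.*ₚ entry l j Q) n) ∎
    where
    open SetoidReasoning 𝓕.setoid
    tail : Fin m → ℕ → 𝓕.Carrier
    tail l = coeff (𝓕.0# ∷ (entry i l P 𝓕τ.*ₚ map frob (entry l j Q)))

    shift : ∀ n → Mτm.coeff (Mat.0# ∷ (P Mτm.*ₚ map frobᴹ Q)) n i j 𝓕.≈ Σ𝓕.sum (λ l → tail l n)
    shift zero    = 𝓕.sym (sum-zero 𝓕.+-commutativeMonoid {m} _ (λ _ → 𝓕.refl))
    shift (suc n) = 𝓕.trans (coeff-entry-* P (map frobᴹ Q) n i j)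
      (Σ𝓕.sum-cong-≋ (λ l → 𝓕.reflexive
        (≡.cong (λ R → coeff (entry i l P 𝓕τ.*ₚ R) n) (entry-frob l j Q))))

  entry-* : ∀ P Q i j → entry i j (P Mτm.*ₚ Q) ≋ ΣFτ.sum (λ l → entry i l P 𝓕τ.*ₚ entry l j Q)
  entry-* P Q i j n = 𝓕.trans (coeff-entry i j (P Mτm.*ₚ Q) n)
    (𝓕.trans (coeff-entry-* P Q n i j)
      (𝓕.sym (FτR.coeff-sum (λ l → entry i l P 𝓕τ.*ₚ entry l j Q) n)))

  ∘ᴹ-cong : ∀ {f g P Q} → f W.≈ g → P MτR.≋ Q → (f ∘ᴹ P) W.≈ (g ∘ᴹ Q)
  ∘ᴹ-cong {f} {g} {P} {Q} f≈g P≋Q j = ΣFτ.sum-cong-≋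
    {x = λ i → f i 𝓕τ.*ₚ entry i j P} {y = λ i → g i 𝓕τ.*ₚ entry i j Q}
    (λ i → Fτ.*-cong {f i} {g i} {entry i j P} {entry i j Q} (f≈g i) (λ n → 𝓕.trans (coeff-entry i j P n)
      (𝓕.trans (P≋Q n i j) (𝓕.sym (coeff-entry i j Q n)))))

  ∘ᴹ-assoc : ∀ f P Q → (f ∘ᴹ (P Mτm.*ₚ Q)) W.≈ (f ∘ᴹ P ∘ᴹ Q)
  ∘ᴹ-assoc f P Q j = begin
    ΣFτ.sum (λ i → f i 𝓕τ.*ₚ entry i j (P Mτm.*ₚ Q))
      ≈⟨ ΣFτ.sum-cong-≋ {y = λ i → f i 𝓕τ.*ₚ PQ i}
           (λ i → FτR.*ₚ-congˡ (f i) (entry i j (P Mτm.*ₚ Q)) (PQ i) (entry-* P Q i j)) ⟩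
    ΣFτ.sum (λ i → f i 𝓕τ.*ₚ PQ i)
      ≈⟨ FτMat.row-assoc f (λ i l → entry i l P) (λ i l → entry i l Q) j ⟨
    (f ∘ᴹ P ∘ᴹ Q) j ∎
    where
    open SetoidReasoning Fτ.setoid
    PQ : Fin m → List 𝓕.Carrier
    PQ i = ΣFτ.sum (λ l → entry i l P 𝓕τ.*ₚ entry l j Q)

  ∘ᴹ-identity : ∀ f → (f ∘ᴹ (Mat.1# ∷ [])) W.≈ f
  ∘ᴹ-identity f j = begin
    (f ∘ᴹ (Mat.1# ∷ [])) j
      ≈⟨ ΣFτ.sum-cong-≋ {y = λ i → f i 𝓕τ.*ₚ FτM.scalar Fτ.1# i j}
           (λ i → FτR.*ₚ-congˡ (f i) (scalar 𝓕.1# i j ∷ []) _ (scalar-constant i)) ⟩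
    ΣFτ.sum (λ i → f i 𝓕τ.*ₚ FτM.scalar Fτ.1# i j)
      ≈⟨ FτMat.row-scalar f Fτ.1# j ⟩
    f j 𝓕τ.*ₚ Fτ.1#
      ≈⟨ FτR.*ₚ-identityʳ (f j) ⟩
    f j ∎
    where
    open SetoidReasoning Fτ.setoid
    -- Off the diagonal the two sides are different lists for zero, `0# ∷ []` and `[]`.
    scalar-constant : ∀ i → (scalar 𝓕.1# i j ∷ []) ≋ FτM.scalar Fτ.1# i j
    scalar-constant i with does (i ≟ j)
    ... | true  = λ _ → 𝓕.refl
    ... | false = FτR.shift-0 [] (λ _ → 𝓕.refl)

  ∘ᴹ-+ : ∀ f g P → ((f W.∙ g) ∘ᴹ P) W.≈ ((f ∘ᴹ P) W.∙ (g ∘ᴹ P))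
  ∘ᴹ-+ f g P j = begin
    ((f W.∙ g) ∘ᴹ P) j
      ≈⟨ ΣFτ.sum-cong-≋ {y = λ i → f i 𝓕τ.*ₚ entry i j P 𝓕τ.+ₚ g i 𝓕τ.*ₚ entry i j P}
           (λ i → FτR.*ₚ-distribʳ (entry i j P) (f i) (g i)) ⟩
    ΣFτ.sum (λ i → f i 𝓕τ.*ₚ entry i j P 𝓕τ.+ₚ g i 𝓕τ.*ₚ entry i j P)
      ≈⟨ ΣFτ.∑-distrib-+ (λ i → f i 𝓕τ.*ₚ entry i j P) (λ i → g i 𝓕τ.*ₚ entry i j P) ⟩
    (f ∘ᴹ P) j 𝓕τ.+ₚ (g ∘ᴹ P) j ∎
    where open SetoidReasoning Fτ.setoid

  ∘ᴹ-scale : ∀ x f P → (scaleᴹ x f ∘ᴹ P) W.≈ scaleᴹ x (f ∘ᴹ P)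
  ∘ᴹ-scale x f P j = begin
    (scaleᴹ x f ∘ᴹ P) j
      ≈⟨ ΣFτ.sum-cong-≋ {y = λ i → scale x (f i 𝓕τ.*ₚ entry i j P)}
           (λ i → FτR.scale-*ₚ x (f i) (entry i j P)) ⟩
    ΣFτ.sum (λ i → scale x (f i 𝓕τ.*ₚ entry i j P))
      ≈⟨ sum-homo Fτ.+-rawMonoid Fτ.+-monoid (scale x) (λ _ → 𝓕.refl) (scale-+ x)
           (λ i → f i 𝓕τ.*ₚ entry i j P) ⟨
    scale x ((f ∘ᴹ P) j) ∎
    where open SetoidReasoning Fτ.setoid

  ∘ᴹ-0 : ∀ P → (W.ε ∘ᴹ P) W.≈ W.ε
  ∘ᴹ-0 P j = sum-zero Fτ.+-commutativeMonoid {m} (λ i → [] 𝓕τ.*ₚ entry i j P) (λ _ _ → 𝓕.refl)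

  ∘ᴹ-sum : ∀ {r} (v : Vector W.Carrier r) P → (ΣW.sum v ∘ᴹ P) W.≈ ΣW.sum (λ i → v i ∘ᴹ P)
  ∘ᴹ-sum v P = sum-homo W.rawMonoid W.monoid (_∘ᴹ P) (∘ᴹ-0 P) (λ f g → ∘ᴹ-+ f g P) v

  scaleᴹ-sum : ∀ {r} x (v : Vector W.Carrier r) → scaleᴹ x (ΣW.sum v) W.≈ ΣW.sum (λ i → scaleᴹ x (v i))
  scaleᴹ-sum x v = sum-homo W.rawMonoid W.monoid (scaleᴹ x) (λ _ _ → 𝓕.refl)
    (λ f g j → scale-+ x (f j) (g j)) v

  ΦT : List Mat
  ΦT = Φ A.X

  open CommutativeSemigroupProperties W.commutativeSemigroup using (interchange)

  ·-+ : ∀ p q f → ((p 𝓕T.+ₚ q) · f) W.≈ ((p · f) W.∙ (q · f))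
  ·-+ []      q       f j n = 𝓕.refl
  ·-+ (x ∷ p) []      f j n = 𝓕.sym (Fτ.+-identityʳ (((x ∷ p) · f) j) n)
  ·-+ (x ∷ p) (y ∷ q) f = begin
    scaleᴹ (x 𝓕.+ y) f W.∙ ((p 𝓕T.+ₚ q) · f′)
      ≈⟨ W.∙-cong {scaleᴹ (x 𝓕.+ y) f} {scaleᴹ x f W.∙ scaleᴹ y f} {(p 𝓕T.+ₚ q) · f′} {(p · f′) W.∙ (q · f′)}
           (λ j → +-scale x y (f j)) (·-+ p q f′) ⟩
    (scaleᴹ x f W.∙ scaleᴹ y f) W.∙ ((p · f′) W.∙ (q · f′))
      ≈⟨ interchange (scaleᴹ x f) (scaleᴹ y f) (p · f′) (q · f′) ⟩
    (scaleᴹ x f W.∙ (p · f′)) W.∙ (scaleᴹ y f W.∙ (q · f′)) ∎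
    where
    open SetoidReasoning W.setoid
    f′ = f ∘ᴹ ΦT

  ·-scale : ∀ x p f → (𝓕T.scale x p · f) W.≈ scaleᴹ x (p · f)
  ·-scale x []      f j n = 𝓕.refl
  ·-scale x (y ∷ p) f = begin
    scaleᴹ (x 𝓕.* y) f W.∙ (𝓕T.scale x p · f′)
      ≈⟨ W.∙-cong {scaleᴹ (x 𝓕.* y) f} {scaleᴹ x (scaleᴹ y f)} {𝓕T.scale x p · f′} {scaleᴹ x (p · f′)}
           (λ j → *-scale x y (f j)) (·-scale x p f′) ⟩
    scaleᴹ x (scaleᴹ y f) W.∙ scaleᴹ x (p · f′)
      ≈⟨ (λ j → scale-+ x (scale y (f j)) ((p · f′) j)) ⟨
    scaleᴹ x (scaleᴹ y f W.∙ (p · f′)) ∎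
    where
    open SetoidReasoning W.setoid
    f′ = f ∘ᴹ ΦT

  -- The action composes f with Φ(T) before it recurses, so the powers of T pile up inside. Left
  -- scaling commutes with composition on the right, which lets one Φ(T) be pulled out;
  -- multiplication by T thereby becomes a single composition in `T-·`.
  ·-∘ᴹ : ∀ p f → (p · (f ∘ᴹ ΦT)) W.≈ ((p · f) ∘ᴹ ΦT)
  ·-∘ᴹ []      f j n = 𝓕.sym (∘ᴹ-0 ΦT j n)
  ·-∘ᴹ (x ∷ p) f = begin
    scaleᴹ x f′ W.∙ (p · (f′ ∘ᴹ ΦT))
      ≈⟨ W.∙-cong {scaleᴹ x f′} {scaleᴹ x f ∘ᴹ ΦT} {p · (f′ ∘ᴹ ΦT)} {(p · f′) ∘ᴹ ΦT}
           (λ j n → 𝓕.sym (∘ᴹ-scale x f ΦT j n)) (·-∘ᴹ p f′) ⟩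
    (scaleᴹ x f ∘ᴹ ΦT) W.∙ ((p · f′) ∘ᴹ ΦT)
      ≈⟨ ∘ᴹ-+ (scaleᴹ x f) (p · f′) ΦT ⟨
    (scaleᴹ x f W.∙ (p · f′)) ∘ᴹ ΦT ∎
    where
    open SetoidReasoning W.setoid
    f′ = f ∘ᴹ ΦT

  1-· : ∀ f → ((𝓕.1# ∷ []) · f) W.≈ f
  1-· f j n = 𝓕.trans (Fτ.+-identityʳ (scale 𝓕.1# (f j)) n) (1-scale (f j) n)

  T-· : ∀ p f → ((𝓕.0# ∷ p) · f) W.≈ ((p · f) ∘ᴹ ΦT)
  T-· p f = begin
    scaleᴹ 𝓕.0# f W.∙ (p · (f ∘ᴹ ΦT))
      ≈⟨ W.∙-cong {scaleᴹ 𝓕.0# f} {W.ε} {p · (f ∘ᴹ ΦT)} {(p · f) ∘ᴹ ΦT} (λ j → 0-scale (f j)) (·-∘ᴹ p f) ⟩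
    W.ε W.∙ ((p · f) ∘ᴹ ΦT)
      ≈⟨ W.identityˡ ((p · f) ∘ᴹ ΦT) ⟩
    (p · f) ∘ᴹ ΦT ∎
    where open SetoidReasoning W.setoid

  -- The 𝓕[T]-submodule generated by finitely many row vectors.

  module Span {r : ℕ} (g : Vector W.Carrier r) where
    open SetoidReasoning W.setoid

    combination : Vector (List 𝓕.Carrier) r → W.Carrier
    combination x = ΣW.sum (λ i → x i · g i)

    -- A record rather than a Σ-type, so that f can be inferred from InSpan f.
    record InSpan (f : W.Carrier) : Set (c ⊔ ℓ) where
      constructor _,_
      field
        coordinates : Vector (List 𝓕.Carrier) r
        expansion   : f W.≈ combination coordinates

    span-cong : ∀ {f h} → f W.≈ h → InSpan h → InSpan f
    span-cong f≈h (x , h≈) = x , λ j n → 𝓕.trans (f≈h j n) (h≈ j n)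

    span-0 : InSpan W.ε
    span-0 = (λ _ → []) , λ j n → 𝓕.sym (sum-zero W {r} (λ _ → W.ε) (λ _ _ _ → 𝓕.refl) j n)

    span-+ : ∀ {f h} → InSpan f → InSpan h → InSpan (f W.∙ h)
    span-+ {f} {h} (x , f≈) (y , h≈) = (λ i → x i 𝓕T.+ₚ y i) , (begin
      f W.∙ h
        ≈⟨ W.∙-cong {f} {combination x} {h} {combination y} f≈ h≈ ⟩
      combination x W.∙ combination y
        ≈⟨ ΣW.∑-distrib-+ (λ i → x i · g i) (λ i → y i · g i) ⟨
      ΣW.sum (λ i → (x i · g i) W.∙ (y i · g i))
        ≈⟨ ΣW.sum-cong-≋ {x = λ i → (x i 𝓕T.+ₚ y i) · g i} (λ i → ·-+ (x i) (y i) (g i)) ⟨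
      combination (λ i → x i 𝓕T.+ₚ y i) ∎)

    span-scale : ∀ y {f} → InSpan f → InSpan (scaleᴹ y f)
    span-scale y {f} (x , f≈) = (λ i → 𝓕T.scale y (x i)) , (begin
      scaleᴹ y f
        ≈⟨ (λ j → scale-cong y (f j) (combination x j) (f≈ j)) ⟩
      scaleᴹ y (combination x)
        ≈⟨ scaleᴹ-sum y (λ i → x i · g i) ⟩
      ΣW.sum (λ i → scaleᴹ y (x i · g i))
        ≈⟨ ΣW.sum-cong-≋ {x = λ i → 𝓕T.scale y (x i) · g i} (λ i → ·-scale y (x i) (g i)) ⟨
      combination (λ i → 𝓕T.scale y (x i)) ∎)

    span-sum : ∀ {s} (v : Vector W.Carrier s) → (∀ i → InSpan (v i)) → InSpan (ΣW.sum v)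
    span-sum {zero}  v v∈ = span-0
    span-sum {suc s} v v∈ = span-+ (v∈ zero) (span-sum (v ∘ suc) (v∈ ∘ suc))

    span-generator : ∀ k → InSpan (g k)
    span-generator k = z , (begin
      g k               ≈⟨ 1-· (g k) ⟨
      (𝓕.1# ∷ []) · g k ≈⟨ diagonal ⟨
      z k · g k         ≈⟨ sum-single W (λ i → z i · g i) k off ⟨
      combination z     ∎)
      where
      z : Vector (List 𝓕.Carrier) r
      z i = if does (i ≟ k) then 𝓕.1# ∷ [] else []

      off : ∀ i → i ≢ k → (z i · g i) W.≈ W.ε
      off i i≢k with i ≟ k
      ... | yes i≡k = ⊥-elim (i≢k i≡k)
      ... | no  _   = λ _ _ → 𝓕.refl

      diagonal : (z k · g k) W.≈ ((𝓕.1# ∷ []) · g k)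
      diagonal with k ≟ k
      ... | yes _  = λ _ _ → 𝓕.refl
      ... | no k≢k = ⊥-elim (k≢k ≡.refl)

    span-T : ∀ {f} → InSpan f → InSpan (f ∘ᴹ ΦT)
    span-T {f} (x , f≈) = (λ i → 𝓕.0# ∷ x i) , (begin
      f ∘ᴹ ΦT
        ≈⟨ ∘ᴹ-cong {f} {combination x} {ΦT} {ΦT} f≈ (λ _ → Mat.refl) ⟩
      combination x ∘ᴹ ΦT
        ≈⟨ ∘ᴹ-sum (λ i → x i · g i) ΦT ⟩
      ΣW.sum (λ i → (x i · g i) ∘ᴹ ΦT)
        ≈⟨ ΣW.sum-cong-≋ {x = λ i → (𝓕.0# ∷ x i) · g i} (λ i → T-· (x i) (g i)) ⟨
      combination (λ i → 𝓕.0# ∷ x i) ∎)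

    -- The factor split off from Φ(Tⁱ⁺¹) meets f first, so f has to vary in the induction.
    span-T^ : ∀ i {f} → InSpan f → InSpan (f ∘ᴹ Φ (T^ i))
    span-T^ zero    {f} f∈ = span-cong (begin
      f ∘ᴹ Φ (T^ 0)       ≈⟨ ∘ᴹ-cong {f} {f} {Φ (T^ 0)} {Mat.1# ∷ []} (λ _ _ → 𝓕.refl) Φ-T^0 ⟩
      f ∘ᴹ (Mat.1# ∷ [])  ≈⟨ ∘ᴹ-identity f ⟩
      f                   ∎) f∈
    span-T^ (suc i) {f} f∈ = span-cong (begin
      f ∘ᴹ Φ (T^ suc i)          ≈⟨ ∘ᴹ-cong {f} {f} {Φ (T^ suc i)} {ΦT Mτm.*ₚ Φ (T^ i)} (λ _ _ → 𝓕.refl) (Φ-T^ i) ⟩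
      f ∘ᴹ (ΦT Mτm.*ₚ Φ (T^ i))  ≈⟨ ∘ᴹ-assoc f ΦT (Φ (T^ i)) ⟩
      f ∘ᴹ ΦT ∘ᴹ Φ (T^ i)        ∎) (span-T^ i (span-T f∈))

  -- Division on the right by Φ(Tⁱ) and the resulting generators.

  module Division {d i : ℕ} {B B⁻¹ : Mat} (0<d : 0 ℕ.< d)
    (F-leading : Mτm.HasLeadingCoeff (Φ (T^ i)) d B) (B⁻¹*B≈1 : B⁻¹ Mat.* B Mat.≈ Mat.1#) where
    open Mτm.HasLeadingCoeff F-leading

    F : List Mat
    F = Φ (T^ i)

    monoᴹ : Vector 𝓕.Carrier m → ℕ → W.Carrier
    monoᴹ v n j = mono (v j) n

    -- Row j of the scalar matrix τⁿ over 𝓕{τ}, that is, e_j τⁿ.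
    generator : ℕ → Fin m → W.Carrier
    generator n = FτM.scalar (mono 𝓕.1# n)

    generators : Vector W.Carrier (d ℕ.* m)
    generators k = generator (toℕ (proj₁ (remQuot {d} m k))) (proj₂ (remQuot {d} m k))

    open Span generators

    generator-in-span : ∀ {n} → n ℕ.< d → ∀ j → InSpan (generator n j)
    generator-in-span {n} n<d j = ≡.subst InSpan eq (span-generator (combine (fromℕ< n<d) j))
      where
      eq : generators (combine (fromℕ< n<d) j) ≡ generator n j
      eq = ≡.trans
        (≡.cong (λ rl → generator (toℕ (proj₁ rl)) (proj₂ rl)) (remQuot-combine (fromℕ< n<d) j))
        (≡.cong (λ l → generator l j) (toℕ-fromℕ< n<d))

    scale-mono : ∀ x n → scale x (mono 𝓕.1# n) ≋ mono x n
    scale-mono x zero    zero    = 𝓕.*-identityʳ x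
    scale-mono x zero    (suc k) = 𝓕.refl
    scale-mono x (suc n) zero    = 𝓕.zeroʳ x
    scale-mono x (suc n) (suc k) = scale-mono x n k

    mono-in-span : ∀ v {n} → n ℕ.< d → InSpan (monoᴹ v n)
    mono-in-span v {n} n<d = span-cong expand
      (span-sum terms (λ j → span-scale (v j) (generator-in-span n<d j)))
      where
      open SetoidReasoning Fτ.setoid
      terms : Vector W.Carrier m
      terms j = scaleᴹ (v j) (generator n j)

      expand : monoᴹ v n W.≈ ΣW.sum terms
      expand j = begin
        mono (v j) n                       ≈⟨ scale-mono (v j) n ⟨
        scale (v j) (mono 𝓕.1# n)          ≈⟨ scale-cong (v j) (generator n j j) (mono 𝓕.1# n)
                                                (FτMat.scalar-diagonal (mono 𝓕.1# n) j) ⟨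
        terms j j                          ≈⟨ sum-single Fτ.+-commutativeMonoid (λ l → terms l j) j
                                                (λ l l≢j → scale-cong (v l) (generator n l j) []
                                                  (FτMat.scalar-off (mono 𝓕.1# n) l≢j)) ⟨
        ΣFτ.sum (λ l → terms l j)          ≈⟨ sum-at terms j ⟨
        ΣW.sum terms j                     ∎

    coeff-mono-∘ᴹ : ∀ w k P l j → coeff ((monoᴹ w k ∘ᴹ P) j) (k ℕ.+ l) 𝓕.≈
      Σ𝓕.sum (λ r → w r 𝓕.* iterate frobᴹ (Mτm.coeff P l) k r j)
    coeff-mono-∘ᴹ w k P l j = begin
      coeff ((monoᴹ w k ∘ᴹ P) j) (k ℕ.+ l)
        ≈⟨ FτR.coeff-sum (λ r → mono (w r) k 𝓕τ.*ₚ entry r j P) (k ℕ.+ l) ⟩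
      Σ𝓕.sum (λ r → coeff (mono (w r) k 𝓕τ.*ₚ entry r j P) (k ℕ.+ l))
        ≈⟨ Σ𝓕.sum-cong-≋ (λ r → begin
             coeff (mono (w r) k 𝓕τ.*ₚ entry r j P) (k ℕ.+ l)
               ≈⟨ FτR.coeff-mono-* (w r) k (entry r j P) l ⟩
             w r 𝓕.* iterate frob (coeff (entry r j P) l) k
               ≈⟨ 𝓕.*-congˡ (frobᵏ.⟦⟧-cong (coeff-entry r j P l)) ⟩
             w r 𝓕.* iterate frob (Mτm.coeff P l r j) k
               ≡⟨ ≡.cong (w r 𝓕.*_) (iterate-frobᴹ (Mτm.coeff P l) k r j) ⟨
             w r 𝓕.* iterate frobᴹ (Mτm.coeff P l) k r j ∎) ⟩
      Σ𝓕.sum (λ r → w r 𝓕.* iterate frobᴹ (Mτm.coeff P l) k r j) ∎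
      where
      open SetoidReasoning 𝓕.setoid
      module frobᵏ = RingMorphisms.IsRingHomomorphism (RingEndo.iterate-homo 𝓕.ring frob-homo k)

    -- All components have degree below n. The strict bound lets n = 0 mean the zero vector, the
    -- base of the induction.
    Bounded : W.Carrier → ℕ → Set ℓ
    Bounded f n = ∀ j k → n ℕ.≤ k → coeff (f j) k 𝓕.≈ 𝓕.0#

    -- w τᵏ ∘ F has leading coefficient w σᵏ(B), so w = v σᵏ(B⁻¹) produces v.
    module Quotient (v : Vector 𝓕.Carrier m) (k : ℕ) where
      private
        module σᵏ = RingMorphisms.IsRingHomomorphism (RingEndo.iterate-homo matrixRing frobᴹ-homo k)

      w : Vector 𝓕.Carrier m
      w r = Σ𝓕.sum (λ l → v l 𝓕.* iterate frobᴹ B⁻¹ k l r)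

      multiple : W.Carrier
      multiple = monoᴹ w k ∘ᴹ F

      multiple-leading : ∀ j → coeff (multiple j) (k ℕ.+ d) 𝓕.≈ v j
      multiple-leading j = begin
        coeff (multiple j) (k ℕ.+ d)
          ≈⟨ coeff-mono-∘ᴹ w k F d j ⟩
        Σ𝓕.sum (λ r → w r 𝓕.* iterate frobᴹ (Mτm.coeff F d) k r j)
          ≈⟨ Σ𝓕.sum-cong-≋ (λ r → 𝓕.*-congˡ {w r} (σᵏ.⟦⟧-cong coeff≈ r j)) ⟩
        Σ𝓕.sum (λ r → w r 𝓕.* iterate frobᴹ B k r j)
          ≈⟨ row-assoc v (iterate frobᴹ B⁻¹ k) (iterate frobᴹ B k) j ⟩
        Σ𝓕.sum (λ l → v l 𝓕.* (iterate frobᴹ B⁻¹ k Mat.* iterate frobᴹ B k) l j)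
          ≈⟨ Σ𝓕.sum-cong-≋ (λ l → 𝓕.*-congˡ {v l} (inverse l j)) ⟩
        Σ𝓕.sum (λ l → v l 𝓕.* scalar 𝓕.1# l j)
          ≈⟨ row-scalar v 𝓕.1# j ⟩
        v j 𝓕.* 𝓕.1#
          ≈⟨ 𝓕.*-identityʳ (v j) ⟩
        v j ∎
        where
        open SetoidReasoning 𝓕.setoid
        inverse : (iterate frobᴹ B⁻¹ k Mat.* iterate frobᴹ B k) Mat.≈ Mat.1#
        inverse = Mat.trans (Mat.sym (σᵏ.*-homo B⁻¹ B)) (Mat.trans (σᵏ.⟦⟧-cong B⁻¹*B≈1) σᵏ.1#-homo)

      multiple-bounded : Bounded multiple (suc (k ℕ.+ d))
      multiple-bounded j n k+d<n = begin
        coeff (multiple j) n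
          ≡⟨ ≡.cong (coeff (multiple j)) (ℕ.m+[n∸m]≡n k≤n) ⟨
        coeff (multiple j) (k ℕ.+ (n ℕ.∸ k))
          ≈⟨ coeff-mono-∘ᴹ w k F (n ℕ.∸ k) j ⟩
        Σ𝓕.sum (λ r → w r 𝓕.* iterate frobᴹ (Mτm.coeff F (n ℕ.∸ k)) k r j)
          ≈⟨ sum-zero 𝓕.+-commutativeMonoid {m} _ (λ r → 𝓕.trans
               (𝓕.*-congˡ {w r} (Mat.trans (σᵏ.⟦⟧-cong (above (n ℕ.∸ k) d<n∸k)) σᵏ.0#-homo r j))
               (𝓕.zeroʳ (w r))) ⟩
        𝓕.0# ∎
        where
        open SetoidReasoning 𝓕.setoid
        k≤n : k ℕ.≤ n
        k≤n = ℕ.≤-trans (ℕ.m≤m+n k d) (ℕ.<⇒≤ k+d<n)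
        d<n∸k : d ℕ.< n ℕ.∸ k
        d<n∸k = ℕ.+-cancelˡ-< k d (n ℕ.∸ k) (≡.subst (k ℕ.+ d ℕ.<_) (≡.sym (ℕ.m+[n∸m]≡n k≤n)) k+d<n)

    mono-bounded : ∀ v n → Bounded (monoᴹ v n) (suc n)
    mono-bounded v n j k n<k = FτR.coeff-mono-≢ (v j) n k (ℕ.<⇒≢ n<k)

    -- Write f = (f - h) + h; the difference has lost its τⁿ term. The vector h is the monomial v τⁿ
    -- itself when n < d, and a multiple of Φ(Tⁱ) otherwise.
    cancel-top : ∀ n f h → (∀ f → Bounded f n → InSpan f) →
                 Bounded f (suc n) → Bounded h (suc n) → (∀ j → coeff (h j) n 𝓕.≈ coeff (f j) n) →
                 InSpan h → InSpan f
    cancel-top n f h lower f-bounded h-bounded agree h∈ = span-cong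
      (λ j l → 𝓕.sym (AbelianGroupProperties.//-rightDividesˡ Fτ.+-abelianGroup (h j) (f j) l))
      (span-+ (lower f-h f-h-bounded) h∈)
      where
      open SetoidReasoning 𝓕.setoid
      f-h : W.Carrier
      f-h j = f j 𝓕τ.+ₚ Fτ.- h j

      equal : ∀ j {l} → n ℕ.< l ⊎ n ≡ l → coeff (f j) l 𝓕.≈ coeff (h j) l
      equal j (inj₁ n<l)    = 𝓕.trans (f-bounded j _ n<l) (𝓕.sym (h-bounded j _ n<l))
      equal j (inj₂ ≡.refl) = 𝓕.sym (agree j)

      f-h-bounded : Bounded f-h n
      f-h-bounded j l n≤l = begin
        coeff (f-h j) l                           ≈⟨ FτR.coeff-+ (f j) (Fτ.- h j) l ⟩
        coeff (f j) l 𝓕.+ coeff (Fτ.- h j) l      ≈⟨ 𝓕.+-congˡ (FτR.coeff-neg (h j) l) ⟩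
        coeff (f j) l 𝓕.- coeff (h j) l           ≈⟨ 𝓕.+-congʳ (equal j (ℕ.m≤n⇒m<n∨m≡n n≤l)) ⟩
        coeff (h j) l 𝓕.- coeff (h j) l           ≈⟨ 𝓕.-‿inverseʳ _ ⟩
        𝓕.0#                                      ∎

    -- Strong induction, because the division step calls it twice: for the remainder, with bound n,
    -- and for the quotient w τᵏ, with bound k + 1. The latter is smaller than n + 1 exactly because
    -- d > 0. Once the quotient lies in the span, closure under Tⁱ puts its product with Φ(Tⁱ)
    -- there.
    bounded-in-span : ∀ n f → Bounded f n → InSpan f
    bounded-in-span = <-rec (λ n → ∀ f → Bounded f n → InSpan f) step
      where
      step : ∀ n → (∀ {l} → l ℕ.< n → ∀ f → Bounded f l → InSpan f) → ∀ f → Bounded f n → InSpan f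
      step zero    rec f f-bounded = span-cong (λ j k → f-bounded j k ℕ.z≤n) span-0
      step (suc n) rec f f-bounded with n ℕ.<? d
      ... | yes n<d = cancel-top n f (monoᴹ v n) (rec ℕ.≤-refl) f-bounded (mono-bounded v n)
        (λ j → FτR.coeff-mono-≡ (v j) n) (mono-in-span v n<d)
        where
        v : Vector 𝓕.Carrier m
        v j = coeff (f j) n
      ... | no n≮d = cancel-top n f multiple (rec ℕ.≤-refl) f-bounded
        (≡.subst (Bounded multiple ∘ suc) k+d≡n multiple-bounded)
        (λ j → ≡.subst (λ l → coeff (multiple j) l 𝓕.≈ v j) k+d≡n (multiple-leading j))
        (span-T^ i (rec (ℕ.s≤s k<n) (monoᴹ w k) (mono-bounded w k)))
        where
        v : Vector 𝓕.Carrier m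
        v j = coeff (f j) n
        k = n ℕ.∸ d
        open Quotient v k
        k+d≡n : k ℕ.+ d ≡ n
        k+d≡n = ℕ.m∸n+n≡m (ℕ.≮⇒≥ n≮d)
        k<n : k ℕ.< n
        k<n = ≡.subst (k ℕ.<_) k+d≡n (ℕ.m<m+n k 0<d)

    coeff-≥length : ∀ p n → length p ℕ.≤ n → coeff p n 𝓕.≈ 𝓕.0#
    coeff-≥length []      n       _           = 𝓕.refl
    coeff-≥length (x ∷ p) (suc n) (ℕ.s≤s p≤n) = coeff-≥length p n p≤n

    bound : ∀ {s} (f : Vector (List 𝓕.Carrier) s) → ∃ λ n → ∀ j → length (f j) ℕ.≤ n
    bound {zero}  f = 0 , λ ()
    bound {suc s} f with bound (f ∘ suc)
    ... | n , f≤n = length (f zero) ℕ.⊔ n , λ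
      { zero    → ℕ.m≤m⊔n (length (f zero)) n
      ; (suc j) → ℕ.≤-trans (f≤n j) (ℕ.m≤n⊔m (length (f zero)) n) }

    abelian : IsAbelian S 𝒜
    abelian = d ℕ.* m , generators , λ f → let n , f≤n = bound f in
      let open InSpan (bounded-in-span n f (λ j k n≤k → coeff-≥length (f j) k (ℕ.≤-trans (f≤n j) n≤k)))
      in coordinates , expansion

theorem9 : ∀ {c ℓ} (S : Setting c ℓ) {m : ℕ} (𝒜 : TModule S m) →
    0 < TModule.degree 𝒜 →
    (∃ λ (i : ℕ) → 0 < i × HasInvertibleLeadingCoeff S 𝒜 (Setting.T^_ S i)) →
    IsAbelian S 𝒜
-- A leading coefficient in degree 0 says that Φ(Tⁱ) is constant, which the positive degree of Φ(T)
-- forbids.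
theorem9 S 𝒜 0<deg (i , 0<i , zero , B , F-leading , _) =
  ⊥-elim (SettingProperties.TModuleProperties.Φ-T^-nonconstant S 𝒜 0<deg 0<i
    (λ n → Twisted.HasLeadingCoeff.above F-leading (suc n) (ℕ.s≤s ℕ.z≤n)))
theorem9 S 𝒜 0<deg (i , 0<i , suc d , B , F-leading , B⁻¹ , B⁻¹*B≈1 , _) =
  HomModule.Division.abelian S 𝒜 {suc d} {i} {B} {B⁻¹} (ℕ.s≤s ℕ.z≤n) F-leading B⁻¹*B≈1
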